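{- Let $n\ge 1$ and let $f$ be a homogeneous symmetric function of degree $n$ with rational coefficients. Let $s_{\tau_n}$ and $s_{\tau'_n}$ be the ribbon Schur functions defined in the context. If $n$ is odd, then $$\langle f,s_{\tau_n}\rangle=\langle f,s_{\tau'_n}\rangle=f[E,0,-E,0,E,0,-E,0,\dots].$$ If $n$ is even, then $$\langle f,s_{\tau_n}\rangle=f[E,-1,-E,1,E,-1,-E,1,\dots],\qquad \langle f,s_{\tau'_n}\rangle=f[E,1,-E,-1,E,1,-E,-1,\dots].$$ The right-hand sides are evaluated umbrally.
   Context: $\langle\cdot,\cdot\rangle$ is the Hall inner product on symmetric functions, for which the Schur functions are orthonormal; $h_i$ is the complete homogeneous symmetric function and $p_i$ the power sum. For a composition $\alpha=(\alpha_1,\dots,\alpha_k)$ of $n$, let $s_{B_\alpha}=\sum_\beta (-1)^{k-\ell(\beta)}h_{\beta_1}h_{\beta_2}\cdots h_{\beta_{\ell(\beta)}}$, summed over all compositions $\beta$ of $n$ obtained from $\alpha$ by merging adjacent parts (including $\beta=\alpha$); this is the skew Schur function of the border strip (ribbon) with row lengths $\alpha$. Let $s_{\tau_n}=s_{B_\alpha}$ with $\alpha=(1,2,2,\dots,2,j)$, where $j=1$ if $n$ is even and $j=2$ if $n$ is odd (the descent composition of an alternating permutation of $[n]$); let $s_{\tau'_n}=s_{B_\beta}$ with $\beta=(2,2,\dots,2)$ if $n$ is even and $\beta=(2,2,\dots,2,1)$ if $n$ is odd (the descent composition of a reverse alternating permutation). Euler numbers $E_n$ are defined by $\sum_{n\ge0}E_nx^n/n!=\sec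 x+\tan x$. Substitution notation: for a symmetric function $f$, $f[a_1,a_2,\dots]$ means write $f$ as a polynomial in $p_1,p_2,\dots$ and set $p_i=a_i$. Thus $[E,0,-E,0,\dots]$ means $p_{2j+1}=(-1)^jE$, $p_{2j}=0$; $[E,-1,-E,1,\dots]$ means $p_{2j+1}=(-1)^jE$, $p_{2j}=(-1)^j$; $[E,1,-E,-1,\dots]$ means $p_{2j+1}=(-1)^jE$, $p_{2j}=(-1)^{j+1}$. Umbral evaluation: the resulting polynomial in the indeterminate $E$ is expanded in powers of $E$ and then, as the last step, each $E^k$ is replaced by $E_k$. -}

module Defs where

open import Data.Nat as ℕ using (ℕ; zero; suc; _≤_; _!)
open import Data.Integer using (+_)
open import Data.Rational using (ℚ; 0ℚ; 1ℚ; _+_; _*_; -_; _-_; _/_)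
open import Data.List using (upTo; List; []; _∷_; _++_; map; concatMap; foldr; length; replicate)
open import Data.List.Relation.Unary.All using (All)
import Data.Nat.ListAction as LA
open import Data.Product using (_×_; _,_)
open import Data.Bool using (Bool; true; false; if_then_else_; _∧_)
open import Relation.Binary.PropositionalEquality using (_≡_)
open import Relation.Nullary.Decidable using (⌊_⌋)

Σℚ : List ℚ → ℚ
Σℚ = foldr _+_ 0ℚ

ℕ→ℚ : ℕ → ℚ
ℕ→ℚ k = + k / 1

sgn : ℕ → ℚ
sgn zero = 1ℚ
sgn (suc k) = - sgn k

-- Euler numbers, via the exponential generating function sec x + tan x
-- = (1 + sin x) / cos x, computed as a formal power series over ℚ.
-- If F = Σ c_n x^n, then cos x · F = 1 + sin x, i.e.
--   c_n = [n = 0] + sin_n - Σ_{k=1}^{n} cos_k c_{n-k}   (cos_0 = 1).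
-- E_n = n! c_n.

invSuc : ℕ → ℚ
invSuc k = + 1 / suc k

invFact : ℕ → ℚ
invFact zero = 1ℚ
invFact (suc k) = invFact k * invSuc k

cosC : ℕ → ℚ
cosC k = go k k
  where
  par : ℕ → Bool
  par zero = true
  par (suc zero) = false
  par (suc (suc m)) = par m
  half : ℕ → ℕ
  half zero = zero
  half (suc zero) = zero
  half (suc (suc m)) = suc (half m)
  go : ℕ → ℕ → ℚ
  go m k = if par m then sgn (half k) * invFact k else 0ℚ

sinC : ℕ → ℚ
sinC zero = 0ℚ
sinC (suc k) = go k
  where
  par : ℕ → Bool
  par zero = true
  par (suc zero) = false
  par (suc (suc m)) = par m
  half : ℕ → ℕ
  half zero = zero
  half (suc zero) = zero
  half (suc (suc m)) = suc (half m)
  go : ℕ → ℚ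
  go k = if par k then sgn (half k) * invFact (suc k) else 0ℚ

conv : ℕ → List ℚ → ℚ
conv j [] = 0ℚ
conv j (x ∷ xs) = cosC (suc j) * x + conv (suc j) xs

secTanRev : ℕ → List ℚ
secTanRev zero = 1ℚ ∷ []
secTanRev (suc n) = (sinC (suc n) - conv 0 (secTanRev n)) ∷ secTanRev n

headℚ : List ℚ → ℚ
headℚ [] = 0ℚ
headℚ (x ∷ _) = x

euler : ℕ → ℚ
euler n = ℕ→ℚ (n !) * headℚ (secTanRev n)

-- Symmetric functions over ℚ, written in the power-sum basis:
-- a list of terms (c , λ) standing for Σ c · p_{λ₁} p_{λ₂} ⋯ .
-- (Over ℚ the p_λ form a basis, so every symmetric function has such a
-- representation.)

Sym : Set
Sym = List (ℚ × List ℕ)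

Homogeneous : ℕ → Sym → Set
Homogeneous n f = All (λ t → All (1 ≤_) (Data.Product.proj₂ t) × LA.sum (Data.Product.proj₂ t) ≡ n) f
  where import Data.Product

oneS : Sym
oneS = (1ℚ , []) ∷ []

pS : ℕ → Sym
pS i = (1ℚ , i ∷ []) ∷ []

scaleS : ℚ → Sym → Sym
scaleS a = map (λ { (c , l) → (a * c , l) })

addS : Sym → Sym → Sym
addS = _++_

mulS : Sym → Sym → Sym
mulS f g = concatMap (λ { (c , l) → map (λ { (d , m) → (c * d , l ++ m) }) g }) f

sumS : List Sym → Sym
sumS = foldr addS []

prodS : List Sym → Sym
prodS = foldr mulS oneS

-- complete homogeneous symmetric functions via Newton's identity
--   k h_k = Σ_{i=1}^{k} p_i h_{k-i},  h_0 = 1.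
-- newton j [h_k, ..., h_0] = Σ_i p_{j+1+i} h_{k-i}
newton : ℕ → List Sym → Sym
newton j [] = []
newton j (h ∷ hs) = addS (mulS (pS (suc j)) h) (newton (suc j) hs)

hRev : ℕ → List Sym
hRev zero = oneS ∷ []
hRev (suc k) = scaleS (invSuc k) (newton 0 (hRev k)) ∷ hRev k

headS : List Sym → Sym
headS [] = []
headS (x ∷ _) = x

hS : ℕ → Sym
hS k = headS (hRev k)

coarsenings : List ℕ → List (List ℕ)
coarsenings [] = [] ∷ []
coarsenings (a ∷ rest) = go a rest
  where
  go : ℕ → List ℕ → List (List ℕ)
  go a [] = (a ∷ []) ∷ []
  go a (b ∷ rest) = map (a ∷_) (go b rest) ++ go (a ℕ.+ b) rest

ribbon : List ℕ → Sym
ribbon α = sumS (map (λ β → scaleS (sgn (length α ℕ.∸ length β)) (prodS (map hS β)))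
                     (coarsenings α))

twos : ℕ → List ℕ
twos zero = []
twos (suc zero) = 1 ∷ []
twos (suc (suc m)) = 2 ∷ twos m

-- descent composition of an alternating permutation of [n], n ≥ 1:
-- (1,2,…,2,1) for n even, (1,2,…,2) for n odd ((1) for n = 1)
tauComp : ℕ → List ℕ
tauComp n = 1 ∷ twos (n ℕ.∸ 1)

-- descent composition of a reverse alternating permutation of [n]
tau'Comp : ℕ → List ℕ
tau'Comp n = twos n

sTau : ℕ → Sym
sTau n = ribbon (tauComp n)

sTau' : ℕ → Sym
sTau' n = ribbon (tau'Comp n)

-- Hall inner product: bilinear, ⟨p_λ , p_μ⟩ = z_λ δ_{λμ}
-- (λ, μ compared as multisets), z_λ = Π_i i^{m_i} m_i!.

count : ℕ → List ℕ → ℕ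
count i [] = 0
count i (x ∷ xs) = if ⌊ i ℕ.≟ x ⌋ then suc (count i xs) else count i xs

allB : List Bool → Bool
allB = foldr _∧_ true

sameMultiset : List ℕ → List ℕ → Bool
sameMultiset l m = allB (map (λ i → ⌊ count i l ℕ.≟ count i m ⌋) (l ++ m))

z : List ℕ → ℕ
z l = LA.product l ℕ.* LA.product (map (λ i → count i l !) (upTo (suc (LA.sum l))))

pInner : List ℕ → List ℕ → ℚ
pInner l m = if sameMultiset l m then ℕ→ℚ (z l) else 0ℚ

⟨_,_⟩ : Sym → Sym → ℚ
⟨ f , g ⟩ = Σℚ (concatMap (λ { (c , l) → map (λ { (d , m) → c * d * pInner l m }) g }) f)

-- Polynomials in an indeterminate E over ℚ (ascending coefficient lists)

Poly : Set
Poly = List ℚ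

addP : Poly → Poly → Poly
addP [] q = q
addP p [] = p
addP (a ∷ p) (b ∷ q) = (a + b) ∷ addP p q

scaleP : ℚ → Poly → Poly
scaleP a = map (a *_)

mulP : Poly → Poly → Poly
mulP [] q = []
mulP (a ∷ p) q = addP (scaleP a q) (0ℚ ∷ mulP p q)

constP : ℚ → Poly
constP a = a ∷ []

substS : Sym → (ℕ → Poly) → Poly
substS f a = foldr addP [] (map (λ { (c , l) → scaleP c (foldr mulP (constP 1ℚ) (map a l)) }) f)

umbralFrom : ℕ → Poly → ℚ
umbralFrom k [] = 0ℚ
umbralFrom k (c ∷ p) = c * euler k + umbralFrom (suc k) p

umbral : Poly → ℚ
umbral = umbralFrom 0

Epoly : ℚ → Poly
Epoly c = 0ℚ ∷ c ∷ []

specOdd : ℕ → Poly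
specOdd zero = constP 1ℚ   -- p_0 never occurs
specOdd (suc zero) = Epoly 1ℚ
specOdd (suc (suc zero)) = []
specOdd (suc (suc (suc zero))) = Epoly (- 1ℚ)
specOdd (suc (suc (suc (suc zero)))) = []
specOdd (suc (suc (suc (suc (suc i))))) = specOdd (suc i)

specEvenτ : ℕ → Poly
specEvenτ zero = constP 1ℚ
specEvenτ (suc zero) = Epoly 1ℚ
specEvenτ (suc (suc zero)) = constP (- 1ℚ)
specEvenτ (suc (suc (suc zero))) = Epoly (- 1ℚ)
specEvenτ (suc (suc (suc (suc zero)))) = constP 1ℚ
specEvenτ (suc (suc (suc (suc (suc i))))) = specEvenτ (suc i)

specEvenτ' : ℕ → Poly
specEvenτ' zero = constP 1ℚ
specEvenτ' (suc zero) = Epoly 1ℚ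
specEvenτ' (suc (suc zero)) = constP 1ℚ
specEvenτ' (suc (suc (suc zero))) = Epoly (- 1ℚ)
specEvenτ' (suc (suc (suc (suc zero)))) = constP (- 1ℚ)
specEvenτ' (suc (suc (suc (suc (suc i))))) = specEvenτ' (suc i)

{-# OPTIONS --safe #-}
module Submission where

-- Send a symmetric function g to the functional l ↦ ⟨p_l , g⟩ on words l.  Since p_i is adjoint to
-- the derivation i ∂/∂p_i, products become shuffle products, and h_a becomes the indicator of
-- degree a.  Put C = Σ (-1)^k h_{2k} and S = Σ (-1)^k h_{2k+1}.  Expanding ribbons along the first
-- row gives Σ s_{τ'_n} = 1/C over even n and S/C over odd n, and Σ s_{τ_n} = S/C over odd n and
-- S²/C + C - 1 over even n ≥ 2.
--
-- The functional M s α evaluates p_{2j+1} ↦ (-1)^j E, p_{2j} ↦ (-1)^j s and then E^k ↦ α k.  Such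
-- functionals multiply by adding the s and multiplying the exponential generating functions of
-- the α.  Since C = M 1 cos and S = M 1 sin, the identities cos (sec + tan) = 1 + sin and
-- sin (sec + tan) = (sec + tan) - cos show that 1/C, S/C and S²/C + C agree, in degrees of the
-- relevant parity, with M (-1), M 0 and M 1 of the Euler numbers.

open import Defs
open import Data.Bool using (Bool; true; false; not; if_then_else_; _∧_)
open import Data.Bool.Properties using (not-involutive)
open import Data.Empty using (⊥-elim)
import Data.Integer as ℤ
import Data.Integer.Properties as ℤₚ
open import Data.List using (List; []; _∷_; map; _++_; length; foldr; upTo)
open import Data.List.Properties using (map-++; map-∘; map-id; map-cong; length-map; upTo-∷ʳ)
open import Data.List.Relation.Unary.All as All using (All; []; _∷_)
import Data.List.Relation.Unary.All.Properties as Allₚ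
open import Data.Nat as ℕ using (ℕ; zero; suc; z≤n; s≤s; _!; _≤_; _%_)
import Data.Nat.Coprimality as Coprime
open import Data.Nat.Induction using (<-rec)
open import Data.Nat.ListAction using (sum; product)
open import Data.Nat.ListAction.Properties using (product-++)
import Data.Nat.Properties as ℕₚ
import Data.Nat.Tactic.RingSolver as ℕ-Ring
open import Data.Product using (_×_; _,_; ∃-syntax)
open import Data.Rational using (ℚ; 0ℚ; 1ℚ; _+_; _*_; -_; _-_; mkℚ)
open import Data.Rational.Properties
open import Data.Rational.Solver using (module +-*-Solver)
open import Data.Sum using (inj₁; inj₂)
open import Relation.Binary.PropositionalEquality using (_≡_; refl; sym; trans; cong; cong₂; subst; module ≡-Reasoning)
open import Relation.Nullary using (¬_; Dec; yes; no; contradiction)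
open import Relation.Nullary.Decidable using (⌊_⌋)
open +-*-Solver using (solve; _:=_; _:+_; _:*_; :-_; _:-_; con)

-- Binomial convolution

-- No quotient is ever formed. Since T 2 = 1 - C, the ribbons `R 2 (twos k)` with k of one parity
-- are the graded parts of a series Q that solves a linear fixed point equation, and it is enough to
-- check that some `M s ε` solves it. The check works one parity at a time: cos (sec + tan) = 1 +
-- sin has one summand too many, and the unwanted one vanishes because the exponent of E has the
-- parity of the degree. This also dictates s. Multiplication by C or S raises s by one. So 1/C
-- needs s = -1, for the product with C to be the unit, and S/C needs s = 0, because S itself has s
-- = 1. A further factor S, for a first row of length 1, turns these into 0 and 1. The induction on
-- the tail of a ribbon needs an arbitrary first row a, since merging rows changes it.

Seq : Set
Seq = ℕ → ℚ

shift : Seq → Seq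
shift α n = α (suc n)

infixl 7 _⊛_

-- The product of exponential generating functions. `shift` is the derivative, so the product rule
-- serves as the recursion and no binomial coefficients appear.
_⊛_ : Seq → Seq → Seq
(α ⊛ β) zero    = α 0 * β 0
(α ⊛ β) (suc n) = (shift α ⊛ β) n + (α ⊛ shift β) n

⊛-cong : ∀ {α α' β β'} → (∀ n → α n ≡ α' n) → (∀ n → β n ≡ β' n) → ∀ n → (α ⊛ β) n ≡ (α' ⊛ β') n
⊛-cong p q zero    = cong₂ _*_ (p 0) (q 0)
⊛-cong p q (suc n) = cong₂ _+_ (⊛-cong (λ k → p (suc k)) q n) (⊛-cong p (λ k → q (suc k)) n)

+-interchange : ∀ a b c d → (a + b) + (c + d) ≡ (a + c) + (b + d)
+-interchange = solve 4 (λ a b c d → (a :+ b) :+ (c :+ d) := (a :+ c) :+ (b :+ d)) refl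

⊛-distribˡ : ∀ α β γ n → (α ⊛ (λ k → β k + γ k)) n ≡ (α ⊛ β) n + (α ⊛ γ) n
⊛-distribˡ α β γ zero    = *-distribˡ-+ (α 0) (β 0) (γ 0)
⊛-distribˡ α β γ (suc n) = trans
  (cong₂ _+_ (⊛-distribˡ (shift α) β γ n) (⊛-distribˡ α (shift β) (shift γ) n))
  (+-interchange ((shift α ⊛ β) n) ((shift α ⊛ γ) n) ((α ⊛ shift β) n) ((α ⊛ shift γ) n))

⊛-negʳ : ∀ α β n → (α ⊛ (λ k → - β k)) n ≡ - (α ⊛ β) n
⊛-negʳ α β zero    = sym (neg-distribʳ-* (α 0) (β 0))
⊛-negʳ α β (suc n) = trans
  (cong₂ _+_ (⊛-negʳ (shift α) β n) (⊛-negʳ α (shift β) n))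
  (sym (neg-distrib-+ ((shift α ⊛ β) n) ((α ⊛ shift β) n)))

⊛-comm : ∀ α β n → (α ⊛ β) n ≡ (β ⊛ α) n
⊛-comm α β zero    = *-comm (α 0) (β 0)
⊛-comm α β (suc n) = trans
  (cong₂ _+_ (⊛-comm (shift α) β n) (⊛-comm α (shift β) n))
  (+-comm ((β ⊛ shift α) n) ((shift β ⊛ α) n))

⊛-distribʳ : ∀ α β γ n → ((λ k → α k + β k) ⊛ γ) n ≡ (α ⊛ γ) n + (β ⊛ γ) n
⊛-distribʳ α β γ n = trans (⊛-comm _ γ n)
  (trans (⊛-distribˡ γ α β n) (cong₂ _+_ (⊛-comm γ α n) (⊛-comm γ β n)))

⊛-assoc : ∀ α β γ n → ((α ⊛ β) ⊛ γ) n ≡ (α ⊛ (β ⊛ γ)) n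
⊛-assoc α β γ zero    = *-assoc (α 0) (β 0) (γ 0)
⊛-assoc α β γ (suc n) = begin
  (shift (α ⊛ β) ⊛ γ) n + ((α ⊛ β) ⊛ shift γ) n
    ≡⟨ cong₂ _+_ (⊛-distribʳ (shift α ⊛ β) (α ⊛ shift β) γ n) (⊛-assoc α β (shift γ) n) ⟩
  (((shift α ⊛ β) ⊛ γ) n + ((α ⊛ shift β) ⊛ γ) n) + (α ⊛ (β ⊛ shift γ)) n
    ≡⟨ cong (_+ (α ⊛ (β ⊛ shift γ)) n) (cong₂ _+_ (⊛-assoc (shift α) β γ n) (⊛-assoc α (shift β) γ n)) ⟩
  ((shift α ⊛ (β ⊛ γ)) n + (α ⊛ (shift β ⊛ γ)) n) + (α ⊛ (β ⊛ shift γ)) n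
    ≡⟨ +-assoc ((shift α ⊛ (β ⊛ γ)) n) ((α ⊛ (shift β ⊛ γ)) n) ((α ⊛ (β ⊛ shift γ)) n) ⟩
  (shift α ⊛ (β ⊛ γ)) n + ((α ⊛ (shift β ⊛ γ)) n + (α ⊛ (β ⊛ shift γ)) n)
    ≡⟨ cong ((shift α ⊛ (β ⊛ γ)) n +_) (⊛-distribˡ α (shift β ⊛ γ) (β ⊛ shift γ) n) ⟨
  (shift α ⊛ (β ⊛ γ)) n + (α ⊛ shift (β ⊛ γ)) n ∎
  where open ≡-Reasoning

⊛-leading : ∀ α β n → (∀ k → k ℕ.< n → β k ≡ 0ℚ) → (α ⊛ β) n ≡ α 0 * β n
⊛-leading α β zero    β≡0 = refl
⊛-leading α β (suc n) β≡0 = begin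
  (shift α ⊛ β) n + (α ⊛ shift β) n
    ≡⟨ cong₂ _+_ (⊛-leading (shift α) β n λ k k<n → β≡0 k (ℕₚ.m<n⇒m<1+n k<n))
                 (⊛-leading α (shift β) n λ k k<n → β≡0 (suc k) (s≤s k<n)) ⟩
  α 1 * β n + α 0 * β (suc n)
    ≡⟨ cong (λ x → α 1 * x + α 0 * β (suc n)) (β≡0 n (ℕₚ.n<1+n n)) ⟩
  α 1 * 0ℚ + α 0 * β (suc n)
    ≡⟨ cong (_+ α 0 * β (suc n)) (*-zeroʳ (α 1)) ⟩
  0ℚ + α 0 * β (suc n)
    ≡⟨ +-identityˡ _ ⟩
  α 0 * β (suc n) ∎
  where open ≡-Reasoning

-- Strong induction: once β vanishes below n, only α 0 * β n survives in degree n. This takes the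
-- place of dividing by cos.
⊛-nonzeroDivisor : ∀ α β → α 0 ≡ 1ℚ → (∀ n → (α ⊛ β) n ≡ 0ℚ) → ∀ n → β n ≡ 0ℚ
⊛-nonzeroDivisor α β α₀≡1 αβ≡0 = <-rec (λ n → β n ≡ 0ℚ) λ n ih → begin
  β n         ≡⟨ *-identityˡ (β n) ⟨
  1ℚ * β n    ≡⟨ cong (_* β n) α₀≡1 ⟨
  α 0 * β n   ≡⟨ ⊛-leading α β n (λ k k<n → ih k<n) ⟨
  (α ⊛ β) n   ≡⟨ αβ≡0 n ⟩
  0ℚ          ∎
  where open ≡-Reasoning

δ : ℕ → Seq
δ zero    zero    = 1ℚ
δ zero    (suc n) = 0ℚ
δ (suc a) zero    = 0ℚ
δ (suc a) (suc n) = δ a n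

δ-refl : ∀ a → δ a a ≡ 1ℚ
δ-refl zero    = refl
δ-refl (suc a) = δ-refl a

δ-≢ : ∀ a n → ¬ a ≡ n → δ a n ≡ 0ℚ
δ-≢ zero    zero    a≢n = ⊥-elim (a≢n refl)
δ-≢ zero    (suc n) a≢n = refl
δ-≢ (suc a) zero    a≢n = refl
δ-≢ (suc a) (suc n) a≢n = δ-≢ a n λ e → a≢n (cong suc e)

⊛-zeroʳ : ∀ α n → (α ⊛ (λ _ → 0ℚ)) n ≡ 0ℚ
⊛-zeroʳ α zero    = *-zeroʳ (α 0)
⊛-zeroʳ α (suc n) = cong₂ _+_ (⊛-zeroʳ (shift α) n) (⊛-zeroʳ α n)

⊛-identityʳ : ∀ α n → (α ⊛ δ 0) n ≡ α n
⊛-identityʳ α zero    = *-identityʳ (α 0)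
⊛-identityʳ α (suc n) = trans (cong₂ _+_ (⊛-identityʳ (shift α) n) (⊛-zeroʳ α n)) (+-identityʳ _)

-- Sine and cosine through their derivatives at 0

cosS sinS : Seq
cosS zero    = 1ℚ
cosS (suc n) = - sinS n
sinS zero    = 0ℚ
sinS (suc n) = cosS n

cos²+sin² : ∀ n → (cosS ⊛ cosS) n + (sinS ⊛ sinS) n ≡ δ 0 n
cos²+sin² zero    = refl
cos²+sin² (suc n) = begin
  ((λ k → - sinS k) ⊛ cosS) n + (cosS ⊛ (λ k → - sinS k)) n + ((cosS ⊛ sinS) n + (sinS ⊛ cosS) n)
    ≡⟨ cong (λ x → x + (cosS ⊛ (λ k → - sinS k)) n + ((cosS ⊛ sinS) n + (sinS ⊛ cosS) n)) (⊛-comm _ cosS n) ⟩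
  (cosS ⊛ (λ k → - sinS k)) n + (cosS ⊛ (λ k → - sinS k)) n + ((cosS ⊛ sinS) n + (sinS ⊛ cosS) n)
    ≡⟨ cong₂ (λ x y → x + x + ((cosS ⊛ sinS) n + y)) (⊛-negʳ cosS sinS n) (⊛-comm sinS cosS n) ⟩
  - (cosS ⊛ sinS) n + - (cosS ⊛ sinS) n + ((cosS ⊛ sinS) n + (cosS ⊛ sinS) n)
    ≡⟨ solve 1 (λ x → (:- x) :+ (:- x) :+ (x :+ x) := con 0ℚ) refl ((cosS ⊛ sinS) n) ⟩
  0ℚ ∎
  where open ≡-Reasoning

-- sin (1 + sin) / cos = (1 + sin) / cos - cos
sin⊛secTan : ∀ ε → (∀ n → (cosS ⊛ ε) n ≡ δ 0 n + sinS n) → ∀ n → (sinS ⊛ ε) n ≡ ε n - cosS n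
sin⊛secTan ε cosε n = begin
  (sinS ⊛ ε) n
    ≡⟨ solve 3 (λ x y z → x := (x :+ ((:- y) :+ z)) :+ (y :- z)) refl ((sinS ⊛ ε) n) (ε n) (cosS n) ⟩
  χ n + (ε n - cosS n)
    ≡⟨ cong (_+ (ε n - cosS n)) (⊛-nonzeroDivisor cosS χ refl cosχ n) ⟩
  0ℚ + (ε n - cosS n)
    ≡⟨ +-identityˡ _ ⟩
  ε n - cosS n ∎
  where
  open ≡-Reasoning
  -- The difference of the two sides. Times cos it becomes sin + sin² - (1 + sin) + cos² = 0.
  χ : Seq
  χ k = (sinS ⊛ ε) k + (- ε k + cosS k)

  cos⊛sin⊛ε : ∀ k → (cosS ⊛ (sinS ⊛ ε)) k ≡ sinS k + (sinS ⊛ sinS) k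
  cos⊛sin⊛ε k = begin
    (cosS ⊛ (sinS ⊛ ε)) k          ≡⟨ ⊛-assoc cosS sinS ε k ⟨
    ((cosS ⊛ sinS) ⊛ ε) k          ≡⟨ ⊛-cong (⊛-comm cosS sinS) (λ _ → refl) k ⟩
    ((sinS ⊛ cosS) ⊛ ε) k          ≡⟨ ⊛-assoc sinS cosS ε k ⟩
    (sinS ⊛ (cosS ⊛ ε)) k          ≡⟨ ⊛-cong (λ _ → refl) cosε k ⟩
    (sinS ⊛ (λ j → δ 0 j + sinS j)) k ≡⟨ ⊛-distribˡ sinS (δ 0) sinS k ⟩
    (sinS ⊛ δ 0) k + (sinS ⊛ sinS) k ≡⟨ cong (_+ (sinS ⊛ sinS) k) (⊛-identityʳ sinS k) ⟩
    sinS k + (sinS ⊛ sinS) k       ∎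

  cosχ : ∀ k → (cosS ⊛ χ) k ≡ 0ℚ
  cosχ k = begin
    (cosS ⊛ χ) k
      ≡⟨ ⊛-distribˡ cosS (sinS ⊛ ε) (λ j → - ε j + cosS j) k ⟩
    (cosS ⊛ (sinS ⊛ ε)) k + (cosS ⊛ (λ j → - ε j + cosS j)) k
      ≡⟨ cong₂ _+_ (cos⊛sin⊛ε k) (⊛-distribˡ cosS (λ j → - ε j) cosS k) ⟩
    (sinS k + (sinS ⊛ sinS) k) + ((cosS ⊛ (λ j → - ε j)) k + (cosS ⊛ cosS) k)
      ≡⟨ cong (λ x → (sinS k + (sinS ⊛ sinS) k) + (x + (cosS ⊛ cosS) k)) (trans (⊛-negʳ cosS ε k) (cong -_ (cosε k))) ⟩
    (sinS k + (sinS ⊛ sinS) k) + (- (δ 0 k + sinS k) + (cosS ⊛ cosS) k)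
      ≡⟨ cong (λ x → (sinS k + (sinS ⊛ sinS) k) + (- (x + sinS k) + (cosS ⊛ cosS) k)) (cos²+sin² k) ⟨
    (sinS k + (sinS ⊛ sinS) k) + (- (((cosS ⊛ cosS) k + (sinS ⊛ sinS) k) + sinS k) + (cosS ⊛ cosS) k)
      ≡⟨ solve 3 (λ s ss cc → (s :+ ss) :+ ((:- ((cc :+ ss) :+ s)) :+ cc) := con 0ℚ) refl (sinS k) ((sinS ⊛ sinS) k) ((cosS ⊛ cosS) k) ⟩
    0ℚ ∎

-- Shuffle products

-- A word i₁ ⋯ i_r stands for p_{i₁+1} ⋯ p_{i_r+1}, and a symmetric function g for l ↦ ⟨p_l , g⟩.
WordFn : Set
WordFn = List ℕ → ℚ

∂ : ℕ → WordFn → WordFn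
∂ i F l = F (i ∷ l)

infixl 7 _⧢_

_⧢_ : WordFn → WordFn → WordFn
(F ⧢ G) []      = F [] * G []
(F ⧢ G) (i ∷ l) = (∂ i F ⧢ G) l + (F ⧢ ∂ i G) l

⧢-cong : ∀ {F F' G G'} → (∀ l → F l ≡ F' l) → (∀ l → G l ≡ G' l) → ∀ l → (F ⧢ G) l ≡ (F' ⧢ G') l
⧢-cong p q []      = cong₂ _*_ (p []) (q [])
⧢-cong p q (i ∷ l) = cong₂ _+_ (⧢-cong (λ k → p (i ∷ k)) q l) (⧢-cong p (λ k → q (i ∷ k)) l)

⧢-congˡ : ∀ {F G G'} → (∀ l → G l ≡ G' l) → ∀ l → (F ⧢ G) l ≡ (F ⧢ G') l
⧢-congˡ = ⧢-cong (λ _ → refl)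

⧢-congʳ : ∀ {F F' G} → (∀ l → F l ≡ F' l) → ∀ l → (F ⧢ G) l ≡ (F' ⧢ G) l
⧢-congʳ p = ⧢-cong p (λ _ → refl)

⧢-comm : ∀ F G l → (F ⧢ G) l ≡ (G ⧢ F) l
⧢-comm F G []      = *-comm (F []) (G [])
⧢-comm F G (i ∷ l) = trans
  (cong₂ _+_ (⧢-comm (∂ i F) G l) (⧢-comm F (∂ i G) l))
  (+-comm ((G ⧢ ∂ i F) l) ((∂ i G ⧢ F) l))

⧢-distribˡ : ∀ F G K l → (F ⧢ (λ k → G k + K k)) l ≡ (F ⧢ G) l + (F ⧢ K) l
⧢-distribˡ F G K []      = *-distribˡ-+ (F []) (G []) (K [])
⧢-distribˡ F G K (i ∷ l) = trans
  (cong₂ _+_ (⧢-distribˡ (∂ i F) G K l) (⧢-distribˡ F (∂ i G) (∂ i K) l))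
  (+-interchange ((∂ i F ⧢ G) l) ((∂ i F ⧢ K) l) ((F ⧢ ∂ i G) l) ((F ⧢ ∂ i K) l))

⧢-distribʳ : ∀ F G K l → ((λ k → F k + G k) ⧢ K) l ≡ (F ⧢ K) l + (G ⧢ K) l
⧢-distribʳ F G K l = trans (⧢-comm _ K l)
  (trans (⧢-distribˡ K F G l) (cong₂ _+_ (⧢-comm K F l) (⧢-comm K G l)))

⧢-scaleˡ : ∀ c F G l → ((λ k → c * F k) ⧢ G) l ≡ c * (F ⧢ G) l
⧢-scaleˡ c F G []      = *-assoc c (F []) (G [])
⧢-scaleˡ c F G (i ∷ l) = trans
  (cong₂ _+_ (⧢-scaleˡ c (∂ i F) G l) (⧢-scaleˡ c F (∂ i G) l))
  (sym (*-distribˡ-+ c _ _))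

⧢-scaleʳ : ∀ c F G l → (F ⧢ (λ k → c * G k)) l ≡ c * (F ⧢ G) l
⧢-scaleʳ c F G l = trans (⧢-comm F _ l) (trans (⧢-scaleˡ c G F l) (cong (c *_) (⧢-comm G F l)))

⧢-negˡ : ∀ F G l → ((λ k → - F k) ⧢ G) l ≡ - (F ⧢ G) l
⧢-negˡ F G []      = sym (neg-distribˡ-* (F []) (G []))
⧢-negˡ F G (i ∷ l) = trans
  (cong₂ _+_ (⧢-negˡ (∂ i F) G l) (⧢-negˡ F (∂ i G) l))
  (sym (neg-distrib-+ ((∂ i F ⧢ G) l) ((F ⧢ ∂ i G) l)))

⧢-negʳ : ∀ F G l → (F ⧢ (λ k → - G k)) l ≡ - (F ⧢ G) l
⧢-negʳ F G l = trans (⧢-comm F _ l) (trans (⧢-negˡ G F l) (cong -_ (⧢-comm G F l)))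

⧢-zeroˡ : ∀ G l → ((λ _ → 0ℚ) ⧢ G) l ≡ 0ℚ
⧢-zeroˡ G []      = *-zeroˡ (G [])
⧢-zeroˡ G (i ∷ l) = cong₂ _+_ (⧢-zeroˡ G l) (⧢-zeroˡ (∂ i G) l)

size : List ℕ → ℕ
size l = sum (map suc l)

H : ℕ → WordFn
H a l = δ a (size l)

⧢-identityˡ : ∀ G l → (H 0 ⧢ G) l ≡ G l
⧢-identityˡ G []      = *-identityˡ (G [])
⧢-identityˡ G (i ∷ l) = trans (cong₂ _+_ (⧢-zeroˡ G l) (⧢-identityˡ (∂ i G) l)) (+-identityˡ _)

-- In degree a + b only the degree b part of the second factor meets h_a. The offsets s and t record
-- the degree already handed to each factor while the word is consumed.
H⧢-local : ∀ {F G} a b s t → (∀ l → t ℕ.+ size l ≡ b → F l ≡ G l) →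
  ∀ l → (s ℕ.+ t) ℕ.+ size l ≡ a ℕ.+ b →
  ((λ k → δ a (s ℕ.+ size k)) ⧢ F) l ≡ ((λ k → δ a (s ℕ.+ size k)) ⧢ G) l
H⧢-local {F} {G} a b s t F≡G [] eq with a ℕ.≟ s ℕ.+ 0
-- The first factor has received exactly a, so cancellation leaves exactly b for the second.
... | yes refl = cong (δ a a *_) (F≡G [] (ℕₚ.+-cancelˡ-≡ s _ _ (trans (sym (ℕₚ.+-assoc s t 0)) (trans eq (cong (ℕ._+ b) (ℕₚ.+-identityʳ s))))))
... | no a≢s = begin
  δ a (s ℕ.+ 0) * F [] ≡⟨ cong (_* F []) (δ-≢ a _ a≢s) ⟩
  0ℚ * F []            ≡⟨ trans (*-zeroˡ (F [])) (sym (*-zeroˡ (G []))) ⟩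
  0ℚ * G []            ≡⟨ cong (_* G []) (δ-≢ a _ a≢s) ⟨
  δ a (s ℕ.+ 0) * G [] ∎
  where open ≡-Reasoning
H⧢-local {F} {G} a b s t F≡G (i ∷ l) eq = cong₂ _+_ first second
  where
  open ≡-Reasoning
  Hˢ : ℕ → WordFn
  Hˢ r k = δ a (r ℕ.+ size k)
  reassoc : ∀ k → Hˢ s (i ∷ k) ≡ Hˢ (s ℕ.+ suc i) k
  reassoc k = cong (δ a) (sym (ℕₚ.+-assoc s (suc i) (size k)))
  first : (∂ i (Hˢ s) ⧢ F) l ≡ (∂ i (Hˢ s) ⧢ G) l
  first = begin
    (∂ i (Hˢ s) ⧢ F) l         ≡⟨ ⧢-congʳ reassoc l ⟩
    (Hˢ (s ℕ.+ suc i) ⧢ F) l   ≡⟨ H⧢-local a b (s ℕ.+ suc i) t F≡G l (trans (cong (ℕ._+ size l) e) (trans (ℕₚ.+-assoc (s ℕ.+ t) (suc i) (size l)) eq)) ⟩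
    (Hˢ (s ℕ.+ suc i) ⧢ G) l   ≡⟨ ⧢-congʳ reassoc l ⟨
    (∂ i (Hˢ s) ⧢ G) l         ∎
    where
    e : (s ℕ.+ suc i) ℕ.+ t ≡ (s ℕ.+ t) ℕ.+ suc i
    e = trans (ℕₚ.+-assoc s (suc i) t) (trans (cong (s ℕ.+_) (ℕₚ.+-comm (suc i) t)) (sym (ℕₚ.+-assoc s t (suc i))))
  second : (Hˢ s ⧢ ∂ i F) l ≡ (Hˢ s ⧢ ∂ i G) l
  second = H⧢-local a b s (t ℕ.+ suc i)
    (λ k e → F≡G (i ∷ k) (trans (sym (ℕₚ.+-assoc t (suc i) (size k))) e))
    l (trans (cong (ℕ._+ size l) (sym (ℕₚ.+-assoc s t (suc i)))) (trans (ℕₚ.+-assoc (s ℕ.+ t) (suc i) (size l)) eq))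

-- The functionals p_{2j+1} ↦ (-1)^j E, p_{2j} ↦ (-1)^j s, followed by E^k ↦ α k.
M : ℚ → Seq → WordFn
M s α []                = α 0
M s α (zero ∷ l)        = M s (shift α) l
M s α (suc zero ∷ l)    = - (s * M s α l)
M s α (suc (suc i) ∷ l) = - M s α (i ∷ l)

M-cong : ∀ s {α β} → (∀ n → α n ≡ β n) → ∀ l → M s α l ≡ M s β l
M-cong s e []                = e 0
M-cong s e (zero ∷ l)        = M-cong s (λ n → e (suc n)) l
M-cong s e (suc zero ∷ l)    = cong (λ x → - (s * x)) (M-cong s e l)
M-cong s e (suc (suc i) ∷ l) = cong -_ (M-cong s e (i ∷ l))

M-+ : ∀ s α β l → M s (λ n → α n + β n) l ≡ M s α l + M s β l
M-+ s α β []                = refl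
M-+ s α β (zero ∷ l)        = M-+ s (shift α) (shift β) l
M-+ s α β (suc zero ∷ l)    = trans (cong (λ x → - (s * x)) (M-+ s α β l))
  (solve 3 (λ s x y → :- (s :* (x :+ y)) := (:- (s :* x)) :+ (:- (s :* y))) refl s (M s α l) (M s β l))
M-+ s α β (suc (suc i) ∷ l) = trans (cong -_ (M-+ s α β (i ∷ l))) (neg-distrib-+ (M s α (i ∷ l)) (M s β (i ∷ l)))

M-neg : ∀ s α l → M s (λ n → - α n) l ≡ - M s α l
M-neg s α []                = refl
M-neg s α (zero ∷ l)        = M-neg s (shift α) l
M-neg s α (suc zero ∷ l)    = trans (cong (λ x → - (s * x)) (M-neg s α l))
  (solve 2 (λ s x → :- (s :* (:- x)) := :- (:- (s :* x))) refl s (M s α l))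
M-neg s α (suc (suc i) ∷ l) = cong -_ (M-neg s α (i ∷ l))

-- Each letter goes to one of the two factors. An even one contributes a signed s or t, hence their
-- sum; an odd one differentiates one of the sequences, which is the recursion of `⊛`.
M-⧢ : ∀ s t α β l → (M s α ⧢ M t β) l ≡ M (s + t) (α ⊛ β) l
M-⧢ s t α β []                = refl
M-⧢ s t α β (zero ∷ l)        = trans
  (cong₂ _+_ (M-⧢ s t (shift α) β l) (M-⧢ s t α (shift β) l))
  (sym (M-+ (s + t) (shift α ⊛ β) (α ⊛ shift β) l))
M-⧢ s t α β (suc zero ∷ l)    = begin
  ((λ k → - (s * M s α k)) ⧢ M t β) l + (M s α ⧢ (λ k → - (t * M t β k))) l
    ≡⟨ cong₂ _+_ (trans (⧢-negˡ _ (M t β) l) (cong -_ (⧢-scaleˡ s (M s α) (M t β) l)))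
                 (trans (⧢-negʳ (M s α) _ l) (cong -_ (⧢-scaleʳ t (M s α) (M t β) l))) ⟩
  - (s * (M s α ⧢ M t β) l) + - (t * (M s α ⧢ M t β) l)
    ≡⟨ solve 3 (λ s t x → (:- (s :* x)) :+ (:- (t :* x)) := :- ((s :+ t) :* x)) refl s t ((M s α ⧢ M t β) l) ⟩
  - ((s + t) * (M s α ⧢ M t β) l)
    ≡⟨ cong (λ x → - ((s + t) * x)) (M-⧢ s t α β l) ⟩
  - ((s + t) * M (s + t) (α ⊛ β) l) ∎
  where open ≡-Reasoning
M-⧢ s t α β (suc (suc i) ∷ l) = begin
  ((λ k → - M s α (i ∷ k)) ⧢ M t β) l + (M s α ⧢ (λ k → - M t β (i ∷ k))) l
    ≡⟨ cong₂ _+_ (⧢-negˡ (∂ i (M s α)) (M t β) l) (⧢-negʳ (M s α) (∂ i (M t β)) l) ⟩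
  - (∂ i (M s α) ⧢ M t β) l + - (M s α ⧢ ∂ i (M t β)) l
    ≡⟨ neg-distrib-+ ((∂ i (M s α) ⧢ M t β) l) ((M s α ⧢ ∂ i (M t β)) l) ⟨
  - ((M s α ⧢ M t β) (i ∷ l))
    ≡⟨ cong -_ (M-⧢ s t α β (i ∷ l)) ⟩
  - M (s + t) (α ⊛ β) (i ∷ l) ∎
  where open ≡-Reasoning

-- Parity, and the functionals of C and S

odd : ℕ → Bool
odd zero    = false
odd (suc n) = not (odd n)

odd-2+ : ∀ n → odd (suc (suc n)) ≡ odd n
odd-2+ n = not-involutive (odd n)

-- Each odd part contributes one E and each even part none, so the exponent of E has the parity of
-- the degree.
M-parity : ∀ s α l → (∀ k → odd k ≡ odd (size l) → α k ≡ 0ℚ) → M s α l ≡ 0ℚ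
M-parity s α []                α≡0 = α≡0 0 refl
M-parity s α (zero ∷ l)        α≡0 = M-parity s (shift α) l λ k e → α≡0 (suc k) (cong not e)
M-parity s α (suc zero ∷ l)    α≡0 = trans
  (cong (λ x → - (s * x)) (M-parity s α l λ k e → α≡0 k (trans e (sym (odd-2+ (size l))))))
  (cong -_ (*-zeroʳ s))
M-parity s α (suc (suc i) ∷ l) α≡0 =
  cong -_ (M-parity s α (i ∷ l) λ k e → α≡0 k (trans e (sym (odd-2+ (size (i ∷ l))))))

M-zero : ∀ s l → M s (λ _ → 0ℚ) l ≡ 0ℚ
M-zero s l = M-parity s (λ _ → 0ℚ) l λ _ _ → refl

M₀-unit : ∀ l → M 0ℚ (δ 0) l ≡ H 0 l
M₀-unit []                = refl
M₀-unit (zero ∷ l)        = M-zero 0ℚ l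
M₀-unit (suc zero ∷ l)    = cong -_ (*-zeroˡ (M 0ℚ (δ 0) l))
M₀-unit (suc (suc i) ∷ l) = cong -_ (M₀-unit (i ∷ l))

mutual
  -- On sequences with α'' = -α, the value s = 1 makes every letter of degree d act as the d-th
  -- derivative, so only the total degree is seen.
  M₁-cos : ∀ l → M 1ℚ cosS l ≡ cosS (size l)
  M₁-cos []                = refl
  M₁-cos (zero ∷ l)        = trans (M-neg 1ℚ sinS l) (cong -_ (M₁-sin l))
  M₁-cos (suc zero ∷ l)    = cong -_ (trans (*-identityˡ _) (M₁-cos l))
  M₁-cos (suc (suc i) ∷ l) = cong -_ (M₁-cos (i ∷ l))

  M₁-sin : ∀ l → M 1ℚ sinS l ≡ sinS (size l)
  M₁-sin []                = refl
  M₁-sin (zero ∷ l)        = M₁-cos l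
  M₁-sin (suc zero ∷ l)    = cong -_ (trans (*-identityˡ _) (M₁-sin l))
  M₁-sin (suc (suc i) ∷ l) = cong -_ (M₁-sin (i ∷ l))

not-flip : ∀ {b c} → not b ≡ c → b ≡ not c
not-flip {true}  refl = refl
not-flip {false} refl = refl

mutual
  cos-odd : ∀ k → odd k ≡ true → cosS k ≡ 0ℚ
  cos-odd (suc k) e = cong -_ (sin-even k (not-flip e))

  sin-even : ∀ k → odd k ≡ false → sinS k ≡ 0ℚ
  sin-even zero    e = refl
  sin-even (suc k) e = cos-odd k (not-flip e)

δ₀-odd : ∀ k → odd k ≡ true → δ 0 k ≡ 0ℚ
δ₀-odd (suc k) e = refl

-- The derivatives of cos at 0 are 1, 0, -1, 0, ..., so delaying `cosS` by a places gives the
-- alternating indicator of a, a + 2, a + 4, ....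
altδ : ℕ → Seq
altδ zero    n       = cosS n
altδ (suc a) zero    = 0ℚ
altδ (suc a) (suc n) = altδ a n

altδ-δ : ∀ a n → altδ a n ≡ δ a n - altδ (suc (suc a)) n
altδ-δ zero    zero          = refl
altδ-δ zero    (suc zero)    = refl
altδ-δ zero    (suc (suc n)) = sym (+-identityˡ _)
altδ-δ (suc a) zero          = refl
altδ-δ (suc a) (suc n)       = altδ-δ a n

altδ-< : ∀ a n → n ℕ.< a → altδ a n ≡ 0ℚ
altδ-< (suc a) zero    n<a       = refl
altδ-< (suc a) (suc n) (s≤s n<a) = altδ-< a n n<a

-- T a = h_a - h_{a+2} + h_{a+4} - ⋯
T : ℕ → WordFn
T a l = altδ a (size l)

T-H : ∀ a l → T a l ≡ H a l - T (suc (suc a)) l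
T-H a l = altδ-δ a (size l)

T₁-sin : ∀ l → T 1 l ≡ M 1ℚ sinS l
T₁-sin l = trans (lemma (size l)) (sym (M₁-sin l))
  where
  lemma : ∀ n → altδ 1 n ≡ sinS n
  lemma zero    = refl
  lemma (suc n) = refl

T⧢-H⧢ : ∀ a F l → (T a ⧢ F) l ≡ (H a ⧢ F) l - (T (suc (suc a)) ⧢ F) l
T⧢-H⧢ a F l = trans (⧢-congʳ (T-H a) l)
  (trans (⧢-distribʳ (H a) (λ k → - T (suc (suc a)) k) F l)
         (cong ((H a ⧢ F) l +_) (⧢-negˡ (T (suc (suc a))) F l)))

T⧢-< : ∀ a s F l → s ℕ.+ size l ℕ.< a → ((λ k → altδ a (s ℕ.+ size k)) ⧢ F) l ≡ 0ℚ
T⧢-< a s F []      s<a = trans (cong (_* F []) (altδ-< a _ s<a)) (*-zeroˡ (F []))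
T⧢-< a s F (i ∷ l) s<a = cong₂ _+_
  (trans (⧢-congʳ (λ k → cong (altδ a) (sym (ℕₚ.+-assoc s (suc i) (size k)))) l)
         (T⧢-< a (s ℕ.+ suc i) F l (subst (ℕ._< a) (sym (ℕₚ.+-assoc s (suc i) (size l))) s<a)))
  (T⧢-< a s (∂ i F) l (ℕₚ.≤-<-trans (ℕₚ.+-monoʳ-≤ s (ℕₚ.m≤n+m (size l) (suc i))) s<a))

-- Ribbons

-- The product of h_a with the ribbon (b, r) is the sum of the ribbons (a, b, r) and (a + b, r).
R : ℕ → List ℕ → WordFn
R a []      = H a
R a (b ∷ r) = λ l → (H a ⧢ R b r) l - R (a ℕ.+ b) r l

-- The degree a + k part of T a · Q + w T (a + 1), which is the sum of the ribbons
-- R a (twos k) over all k of a fixed parity.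
RibbonFormula : ℕ → WordFn → ℚ → Set
RibbonFormula k Q w = ∀ a l → size l ≡ a ℕ.+ k → R a (twos k) l ≡ (T a ⧢ Q) l + w * T (suc a) l

-- Since T 2 = 1 - C, the second hypothesis says C · Q = w T 3 in degree 2 + k. For w = 0 this is C
-- · Q = 1 in positive even degrees; for w = -1 it is C · Q = S in odd degrees from 3 on.
R₂-formula : ∀ {k Q w} → RibbonFormula k Q w →
  (∀ l → size l ≡ 2 ℕ.+ k → (T 2 ⧢ Q) l + w * T 3 l ≡ Q l) →
  ∀ l → size l ≡ 2 ℕ.+ k → R 2 (twos k) l ≡ Q l
R₂-formula formula fix l e = trans (formula 2 l e) (fix l e)

-- Splitting off a row 2 leaves h_a times a ribbon already identified with Q, minus a ribbon with
-- first row a + 2 and the shorter tail. The telescoping T a = h_a - T (a + 2) reassembles the two.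
formula-step : ∀ {k Q w} → RibbonFormula k Q w →
  (∀ l → size l ≡ 2 ℕ.+ k → (T 2 ⧢ Q) l + w * T 3 l ≡ Q l) →
  RibbonFormula (suc (suc k)) Q w
formula-step {k} {Q} {w} formula fix a l e = begin
  (H a ⧢ R 2 (twos k)) l - R (a ℕ.+ 2) (twos k) l
    ≡⟨ cong₂ _-_ (H⧢-local a (2 ℕ.+ k) 0 0 (R₂-formula {w = w} formula fix) l e)
                 (trans (cong (λ b → R b (twos k) l) (ℕₚ.+-comm a 2)) (formula (suc (suc a)) l e')) ⟩
  (H a ⧢ Q) l - ((T (2 ℕ.+ a) ⧢ Q) l + w * T (3 ℕ.+ a) l)
    ≡⟨ solve 4 (λ h t w u → h :- (t :+ w :* u) := (h :- t) :+ w :* (con 0ℚ :- u)) refl ((H a ⧢ Q) l) ((T (2 ℕ.+ a) ⧢ Q) l) w (T (3 ℕ.+ a) l) ⟩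
  ((H a ⧢ Q) l - (T (2 ℕ.+ a) ⧢ Q) l) + w * (0ℚ - T (3 ℕ.+ a) l)
    ≡⟨ cong₂ _+_ (T⧢-H⧢ a Q l) (cong (w *_) (trans (T-H (suc a) l) (cong (_- T (3 ℕ.+ a) l) H≡0))) ⟨
  (T a ⧢ Q) l + w * T (suc a) l ∎
  where
  open ≡-Reasoning
  e' : size l ≡ suc (suc a) ℕ.+ k
  e' = trans e (trans (ℕₚ.+-suc a (suc k)) (cong suc (ℕₚ.+-suc a k)))
  -- The degree is at least a + 2, so `T (suc a)` loses its leading term and equals minus
  -- `T (3 ℕ.+ a)`.
  H≡0 : H (suc a) l ≡ 0ℚ
  H≡0 = δ-≢ (suc a) (size l) λ p → ℕₚ.m≢1+m+n (suc a) (trans p e')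

-- The Euler numbers enter only through these facts: the two initial values feed the base cases, and
-- the product with cos feeds the fixed point equations.
module Ribbons (ε : Seq) (ε₀≡1 : ε 0 ≡ 1ℚ) (ε₁≡1 : ε 1 ≡ 1ℚ) (cosε : ∀ n → (cosS ⊛ ε) n ≡ δ 0 n + sinS n) where
  open ≡-Reasoning

  T⧢-truncate : ∀ a F l → size l ℕ.< 2 ℕ.+ a → (T a ⧢ F) l ≡ (H a ⧢ F) l
  T⧢-truncate a F l l<a = trans (T⧢-H⧢ a F l)
    (trans (cong (λ x → (H a ⧢ F) l - x) (T⧢-< (2 ℕ.+ a) 0 F l l<a)) (+-identityʳ _))

  T-truncate : ∀ a l → size l ℕ.< 2 ℕ.+ a → T a l ≡ H a l
  T-truncate a l l<a = trans (T-H a l) (trans (cong (λ x → H a l - x) (altδ-< (2 ℕ.+ a) _ l<a)) (+-identityʳ _))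

  formula₀ : ∀ s → RibbonFormula 0 (M s ε) 0ℚ
  formula₀ s a l e = sym (begin
    (T a ⧢ M s ε) l + 0ℚ * T (suc a) l
      ≡⟨ cong₂ _+_ (T⧢-truncate a (M s ε) l (s≤s (ℕₚ.m≤n⇒m≤1+n (ℕₚ.≤-reflexive (trans e (ℕₚ.+-identityʳ a)))))) (*-zeroˡ (T (suc a) l)) ⟩
    (H a ⧢ M s ε) l + 0ℚ
      ≡⟨ +-identityʳ _ ⟩
    (H a ⧢ M s ε) l
      ≡⟨ H⧢-local a 0 0 0 low l e ⟩
    (H a ⧢ H 0) l
      ≡⟨ trans (⧢-comm (H a) (H 0) l) (⧢-identityˡ (H a) l) ⟩
    H a l ∎)
    where
    low : ∀ k → size k ≡ 0 → M s ε k ≡ H 0 k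
    low [] _ = ε₀≡1

  -- The ribbon (a, 1) is h_a h_1 - h_{a+1}; the merged term is the origin of w = -1. Only the
  -- degree 1 part of Q takes part, whence `ε₁≡1`.
  formula₁ : ∀ s → RibbonFormula 1 (M s ε) (- 1ℚ)
  formula₁ s a l e = sym (begin
    (T a ⧢ M s ε) l + - 1ℚ * T (suc a) l
      ≡⟨ cong₂ _+_ (T⧢-truncate a (M s ε) l (s≤s (ℕₚ.≤-reflexive e'))) (cong (- 1ℚ *_) (T-truncate (suc a) l (s≤s (ℕₚ.m≤n⇒m≤1+n (ℕₚ.≤-reflexive e'))))) ⟩
    (H a ⧢ M s ε) l + - 1ℚ * H (suc a) l
      ≡⟨ cong₂ _+_ (H⧢-local a 1 0 0 low l e) (sym (neg-distribˡ-* 1ℚ (H (suc a) l))) ⟩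
    (H a ⧢ H 1) l - 1ℚ * H (suc a) l
      ≡⟨ cong (λ x → (H a ⧢ H 1) l - x) (*-identityˡ (H (suc a) l)) ⟩
    (H a ⧢ H 1) l - H (suc a) l
      ≡⟨ cong (λ b → (H a ⧢ H 1) l - H b l) (ℕₚ.+-comm 1 a) ⟩
    (H a ⧢ H 1) l - H (a ℕ.+ 1) l ∎)
    where
    e' : size l ≡ suc a
    e' = trans e (ℕₚ.+-comm a 1)
    low : ∀ k → size k ≡ 1 → M s ε k ≡ H 1 k
    low (zero ∷ []) _ = ε₁≡1

  -- T 2 = 1 - C, and C = M 1 cos turns `M s ε` into `M (1ℚ + s)` of cos · ε = 1 + sin.
  T₂⧢ : ∀ s l → (T 2 ⧢ M s ε) l ≡ M s ε l - (M (1ℚ + s) (δ 0) l + M (1ℚ + s) sinS l)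
  T₂⧢ s l = begin
    (T 2 ⧢ M s ε) l
      ≡⟨ solve 2 (λ x y → x := y :- (y :- x)) refl ((T 2 ⧢ M s ε) l) ((H 0 ⧢ M s ε) l) ⟩
    (H 0 ⧢ M s ε) l - ((H 0 ⧢ M s ε) l - (T 2 ⧢ M s ε) l)
      ≡⟨ cong₂ _-_ (⧢-identityˡ (M s ε) l) (sym (T⧢-H⧢ 0 (M s ε) l)) ⟩
    M s ε l - (T 0 ⧢ M s ε) l
      ≡⟨ cong (λ x → M s ε l - x) (trans (⧢-congʳ (λ k → sym (M₁-cos k)) l) (M-⧢ 1ℚ s cosS ε l)) ⟩
    M s ε l - M (1ℚ + s) (cosS ⊛ ε) l
      ≡⟨ cong (λ x → M s ε l - x) (trans (M-cong (1ℚ + s) cosε l) (M-+ (1ℚ + s) (δ 0) sinS l)) ⟩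
    M s ε l - (M (1ℚ + s) (δ 0) l + M (1ℚ + s) sinS l) ∎

  T₁⧢ : ∀ s l → (T 1 ⧢ M s ε) l ≡ M (1ℚ + s) ε l - M (1ℚ + s) cosS l
  T₁⧢ s l = begin
    (T 1 ⧢ M s ε) l                      ≡⟨ ⧢-congʳ T₁-sin l ⟩
    (M 1ℚ sinS ⧢ M s ε) l                ≡⟨ M-⧢ 1ℚ s sinS ε l ⟩
    M (1ℚ + s) (sinS ⊛ ε) l              ≡⟨ M-cong (1ℚ + s) (sin⊛secTan ε cosε) l ⟩
    M (1ℚ + s) (λ n → ε n - cosS n) l    ≡⟨ M-+ (1ℚ + s) ε (λ n → - cosS n) l ⟩
    M (1ℚ + s) ε l + M (1ℚ + s) (λ n → - cosS n) l ≡⟨ cong (M (1ℚ + s) ε l +_) (M-neg (1ℚ + s) cosS l) ⟩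
    M (1ℚ + s) ε l - M (1ℚ + s) cosS l   ∎

  -- With s = -1 the unwanted terms are `M 0ℚ (δ 0)`, the unit, which vanishes in positive degree,
  -- and `M 0ℚ sinS`, which vanishes by parity.
  fix-even : ∀ k → odd k ≡ false → ∀ l → size l ≡ 2 ℕ.+ k → (T 2 ⧢ M (- 1ℚ) ε) l + 0ℚ * T 3 l ≡ M (- 1ℚ) ε l
  fix-even k k-even l e = begin
    (T 2 ⧢ M (- 1ℚ) ε) l + 0ℚ * T 3 l
      ≡⟨ cong₂ _+_ (T₂⧢ (- 1ℚ) l) (*-zeroˡ (T 3 l)) ⟩
    (M (- 1ℚ) ε l - (M 0ℚ (δ 0) l + M 0ℚ sinS l)) + 0ℚ
      ≡⟨ cong₂ (λ x y → (M (- 1ℚ) ε l - (x + y)) + 0ℚ)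
           (trans (M₀-unit l) (cong (δ 0) e))
           (M-parity 0ℚ sinS l λ j p → sin-even j (trans p (trans (cong odd e) (trans (odd-2+ k) k-even)))) ⟩
    (M (- 1ℚ) ε l - (0ℚ + 0ℚ)) + 0ℚ
      ≡⟨ trans (+-identityʳ _) (+-identityʳ _) ⟩
    M (- 1ℚ) ε l ∎

  -- With s = 0 the term `M 1ℚ (δ 0)` vanishes by parity, while `M 1ℚ sinS` is S, which equals minus
  -- T 3 in this degree and cancels against w = -1.
  fix-odd : ∀ k → odd k ≡ true → ∀ l → size l ≡ 2 ℕ.+ k → (T 2 ⧢ M 0ℚ ε) l + - 1ℚ * T 3 l ≡ M 0ℚ ε l
  fix-odd k k-odd l e = begin
    (T 2 ⧢ M 0ℚ ε) l + - 1ℚ * T 3 l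
      ≡⟨ cong (_+ - 1ℚ * T 3 l) (T₂⧢ 0ℚ l) ⟩
    (M 0ℚ ε l - (M 1ℚ (δ 0) l + M 1ℚ sinS l)) + - 1ℚ * T 3 l
      ≡⟨ cong₂ (λ x y → (M 0ℚ ε l - (x + y)) + - 1ℚ * T 3 l)
           (M-parity 1ℚ (δ 0) l λ j p → δ₀-odd j (trans p (trans (cong odd e) (trans (odd-2+ k) k-odd))))
           (trans (sym (T₁-sin l)) (trans (T-H 1 l) (cong (λ n → δ 1 n - T 3 l) e))) ⟩
    (M 0ℚ ε l - (0ℚ + (0ℚ - T 3 l))) + - 1ℚ * T 3 l
      ≡⟨ solve 2 (λ x t → (x :- (con 0ℚ :+ (con 0ℚ :- t))) :+ con (- 1ℚ) :* t := x) refl (M 0ℚ ε l) (T 3 l) ⟩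
    M 0ℚ ε l ∎

  formula-even : ∀ k → odd k ≡ false → RibbonFormula k (M (- 1ℚ) ε) 0ℚ
  formula-even zero          _ = formula₀ (- 1ℚ)
  formula-even (suc (suc k)) e = formula-step {w = 0ℚ} (formula-even k e') (fix-even k e')
    where e' = trans (sym (odd-2+ k)) e

  formula-odd : ∀ k → odd k ≡ true → RibbonFormula k (M 0ℚ ε) (- 1ℚ)
  formula-odd (suc zero)    _ = formula₁ 0ℚ
  formula-odd (suc (suc k)) e = formula-step {w = - 1ℚ} (formula-odd k e') (fix-odd k e')
    where e' = trans (sym (odd-2+ k)) e

  τ'-even : ∀ k → odd k ≡ false → ∀ l → size l ≡ 2 ℕ.+ k → R 2 (twos k) l ≡ M (- 1ℚ) ε l
  τ'-even k e = R₂-formula {w = 0ℚ} (formula-even k e) (fix-even k e)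

  τ'-odd : ∀ k → odd k ≡ true → ∀ l → size l ≡ 2 ℕ.+ k → R 2 (twos k) l ≡ M 0ℚ ε l
  τ'-odd k e = R₂-formula {w = - 1ℚ} (formula-odd k e) (fix-odd k e)

  -- The composition (1) does not begin with a row 2, so the fixed point argument does not reach it.
  τ'-one : ∀ l → size l ≡ 1 → R 1 [] l ≡ M 0ℚ ε l
  τ'-one (zero ∷ []) _ = sym ε₁≡1

  τ-odd : ∀ k → odd k ≡ false → ∀ l → size l ≡ suc k → R 1 (twos k) l ≡ M 0ℚ ε l
  τ-odd k k-even l e = begin
    R 1 (twos k) l
      ≡⟨ formula-even k k-even 1 l e ⟩
    (T 1 ⧢ M (- 1ℚ) ε) l + 0ℚ * T 2 l
      ≡⟨ cong₂ _+_ (T₁⧢ (- 1ℚ) l) (*-zeroˡ (T 2 l)) ⟩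
    (M 0ℚ ε l - M 0ℚ cosS l) + 0ℚ
      ≡⟨ cong (λ x → (M 0ℚ ε l - x) + 0ℚ)
           (M-parity 0ℚ cosS l λ j p → cos-odd j (trans p (trans (cong odd e) (cong not k-even)))) ⟩
    (M 0ℚ ε l - 0ℚ) + 0ℚ
      ≡⟨ trans (+-identityʳ _) (+-identityʳ _) ⟩
    M 0ℚ ε l ∎

  -- The leftover `M 1ℚ cosS` is C, which in positive degree is minus T 2; the term with w = -1
  -- removes it.
  τ-even : ∀ k → odd k ≡ true → ∀ l → size l ≡ suc k → R 1 (twos k) l ≡ M 1ℚ ε l
  τ-even k k-odd l e = begin
    R 1 (twos k) l
      ≡⟨ formula-odd k k-odd 1 l e ⟩
    (T 1 ⧢ M 0ℚ ε) l + - 1ℚ * T 2 l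
      ≡⟨ cong (_+ - 1ℚ * T 2 l) (T₁⧢ 0ℚ l) ⟩
    (M 1ℚ ε l - M 1ℚ cosS l) + - 1ℚ * T 2 l
      ≡⟨ cong (λ x → (M 1ℚ ε l - x) + - 1ℚ * T 2 l)
           (trans (M₁-cos l) (trans (T-H 0 l) (cong (λ n → δ 0 n - T 2 l) e))) ⟩
    (M 1ℚ ε l - (0ℚ - T 2 l)) + - 1ℚ * T 2 l
      ≡⟨ solve 2 (λ x t → (x :- (con 0ℚ :- t)) :+ con (- 1ℚ) :* t := x) refl (M 1ℚ ε l) (T 2 l) ⟩
    M 1ℚ ε l ∎

-- Natural numbers and their inverses in ℚ

ℕ→ℚ-mkℚ : ∀ k → ℕ→ℚ k ≡ mkℚ (ℤ.+ k) 0 (Coprime.sym (Coprime.1-coprimeTo k))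
ℕ→ℚ-mkℚ k = normalize-coprime (Coprime.sym (Coprime.1-coprimeTo k))

invSuc-mkℚ : ∀ k → invSuc k ≡ mkℚ (ℤ.+ 1) k (Coprime.1-coprimeTo (suc k))
invSuc-mkℚ k = normalize-coprime (Coprime.1-coprimeTo (suc k))

ℕ→ℚ-+ : ∀ m n → ℕ→ℚ (m ℕ.+ n) ≡ ℕ→ℚ m + ℕ→ℚ n
ℕ→ℚ-+ m n = sym (trans (cong₂ _+_ (ℕ→ℚ-mkℚ m) (ℕ→ℚ-mkℚ n))
  (/-cong {q₁ = 1} {q₂ = 1} (trans (cong₂ ℤ._+_ (ℤₚ.*-identityʳ (ℤ.+ m)) (ℤₚ.*-identityʳ (ℤ.+ n))) (sym (ℤₚ.pos-+ m n))) refl))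

ℕ→ℚ-* : ∀ m n → ℕ→ℚ (m ℕ.* n) ≡ ℕ→ℚ m * ℕ→ℚ n
ℕ→ℚ-* m n = sym (trans (cong₂ _*_ (ℕ→ℚ-mkℚ m) (ℕ→ℚ-mkℚ n))
  (/-cong {q₁ = 1} {q₂ = 1} (sym (ℤₚ.pos-* m n)) refl))

ℕ→ℚ-invSuc : ∀ k → ℕ→ℚ (suc k) * invSuc k ≡ 1ℚ
ℕ→ℚ-invSuc k = trans (cong₂ _*_ (ℕ→ℚ-mkℚ (suc k)) (invSuc-mkℚ k))
  (*-inverseʳ (mkℚ (ℤ.+ suc k) 0 (Coprime.sym (Coprime.1-coprimeTo (suc k)))))

Σℚ-++ : ∀ xs ys → Σℚ (xs ++ ys) ≡ Σℚ xs + Σℚ ys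
Σℚ-++ []       ys = sym (+-identityˡ (Σℚ ys))
Σℚ-++ (x ∷ xs) ys = trans (cong (x +_) (Σℚ-++ xs ys)) (sym (+-assoc x (Σℚ xs) (Σℚ ys)))

-- The Hall inner product of power sums

count-∷ : ∀ i x xs → count i (x ∷ xs) ≡ (if ⌊ i ℕ.≟ x ⌋ then 1 else 0) ℕ.+ count i xs
count-∷ i x xs with ⌊ i ℕ.≟ x ⌋
... | true  = refl
... | false = refl

count-same : ∀ i xs → count i (i ∷ xs) ≡ suc (count i xs)
count-same i xs with i ℕ.≟ i
... | yes _  = refl
... | no i≢i = ⊥-elim (i≢i refl)

count-diff : ∀ {i x} xs → ¬ i ≡ x → count i (x ∷ xs) ≡ count i xs
count-diff {i} {x} xs i≢x with i ℕ.≟ x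
... | yes i≡x = ⊥-elim (i≢x i≡x)
... | no _    = refl

count-cong : ∀ i x xs ys → count i xs ≡ count i ys → count i (x ∷ xs) ≡ count i (x ∷ ys)
count-cong i x xs ys e = trans (count-∷ i x xs)
  (trans (cong ((if ⌊ i ℕ.≟ x ⌋ then 1 else 0) ℕ.+_) e) (sym (count-∷ i x ys)))

count-cancel : ∀ i x xs ys → count i (x ∷ xs) ≡ count i (x ∷ ys) → count i xs ≡ count i ys
count-cancel i x xs ys e = ℕₚ.+-cancelˡ-≡ (if ⌊ i ℕ.≟ x ⌋ then 1 else 0) _ _
  (trans (sym (count-∷ i x xs)) (trans e (count-∷ i x ys)))

count-swap : ∀ i x y xs → count i (x ∷ y ∷ xs) ≡ count i (y ∷ x ∷ xs)
count-swap i x y xs with ⌊ i ℕ.≟ x ⌋ | ⌊ i ℕ.≟ y ⌋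
... | true  | true  = refl
... | true  | false = refl
... | false | true  = refl
... | false | false = refl

SameCounts : List ℕ → List ℕ → Set
SameCounts l m = ∀ i → count i l ≡ count i m

allB-true : ∀ {f : ℕ → Bool} {xs} → All (λ x → f x ≡ true) xs → allB (map f xs) ≡ true
allB-true []        = refl
allB-true (px ∷ ps) = cong₂ _∧_ px (allB-true ps)

allB-All : ∀ {f : ℕ → Bool} xs → allB (map f xs) ≡ true → All (λ x → f x ≡ true) xs
allB-All []               _ = []
allB-All {f} (x ∷ xs) e with f x in fx
... | true = fx ∷ allB-All xs e

≟-true : ∀ {a b} → a ≡ b → ⌊ a ℕ.≟ b ⌋ ≡ true
≟-true {a} {b} a≡b with a ℕ.≟ b
... | yes _  = refl
... | no a≢b = ⊥-elim (a≢b a≡b)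

≟-true⁻¹ : ∀ {a b} → ⌊ a ℕ.≟ b ⌋ ≡ true → a ≡ b
≟-true⁻¹ {a} {b} e with a ℕ.≟ b
... | yes a≡b = a≡b

count-All : ∀ {P : ℕ → Set} i xs → All P xs → ¬ count i xs ≡ 0 → P i
count-All i []       []        c≢0 = ⊥-elim (c≢0 refl)
count-All i (x ∷ xs) (px ∷ ps) c≢0 with i ℕ.≟ x
... | yes refl = px
... | no _     = count-All i xs ps c≢0

sameMultiset-complete : ∀ l m → SameCounts l m → sameMultiset l m ≡ true
sameMultiset-complete l m same = allB-true (All.universal (λ i → ≟-true (same i)) (l ++ m))

-- The test inspects only entries of l and m; any other number has count zero in both.
sameMultiset-sound : ∀ l m → sameMultiset l m ≡ true → SameCounts l m
sameMultiset-sound l m e i with count i l ℕ.≟ 0 | count i m ℕ.≟ 0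
... | yes l₀ | yes m₀ = trans l₀ (sym m₀)
... | no l≢0 | _      = ≟-true⁻¹ (count-All i l (Allₚ.++⁻ˡ l (allB-All (l ++ m) e)) l≢0)
... | yes _  | no m≢0 = ≟-true⁻¹ (count-All i m (Allₚ.++⁻ʳ l (allB-All (l ++ m) e)) m≢0)

sameCounts? : ∀ l m → Dec (SameCounts l m)
sameCounts? l m with sameMultiset l m in e
... | true  = yes (sameMultiset-sound l m e)
... | false = no λ same → contradiction (trans (sym e) (sameMultiset-complete l m same)) λ ()

pInner-same : ∀ l m → SameCounts l m → pInner l m ≡ ℕ→ℚ (z l)
pInner-same l m same rewrite sameMultiset-complete l m same = refl

pInner-differ : ∀ l m → ¬ SameCounts l m → pInner l m ≡ 0ℚ
pInner-differ l m differ with sameMultiset l m in e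
... | true  = ⊥-elim (differ (sameMultiset-sound l m e))
... | false = refl

-- The monomials of ∂ p_m / ∂ p_j, listed with multiplicity.
removals : ℕ → List ℕ → List (List ℕ)
removals j []      = []
removals j (x ∷ m) =
  if ⌊ j ℕ.≟ x ⌋ then m ∷ map (x ∷_) (removals j m) else map (x ∷_) (removals j m)

prepend-counts : ∀ j x m r → SameCounts (j ∷ r) m → SameCounts (j ∷ x ∷ r) (x ∷ m)
prepend-counts j x m r same i = trans (count-swap i j x r) (count-cong i x (j ∷ r) m (same i))

removals-counts : ∀ j m → All (λ r → SameCounts (j ∷ r) m) (removals j m)
removals-counts j []      = []
removals-counts j (x ∷ m) with j ℕ.≟ x
... | yes refl = (λ _ → refl) ∷ Allₚ.map⁺ (All.map (λ {r} → prepend-counts j x m r) (removals-counts j m))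
... | no _     = Allₚ.map⁺ (All.map (λ {r} → prepend-counts j x m r) (removals-counts j m))

length-removals : ∀ j m → length (removals j m) ≡ count j m
length-removals j []      = refl
length-removals j (x ∷ m) with ⌊ j ℕ.≟ x ⌋
... | true  = cong suc (trans (length-map (x ∷_) (removals j m)) (length-removals j m))
... | false = trans (length-map (x ∷_) (removals j m)) (length-removals j m)

Σℚ-const : ∀ {A : Set} (f : A → ℚ) {c} {xs} → All (λ x → f x ≡ c) xs → Σℚ (map f xs) ≡ ℕ→ℚ (length xs) * c
Σℚ-const f {c} []                   = sym (*-zeroˡ c)
Σℚ-const f {c} {x ∷ xs} (px ∷ ps) = begin
  f x + Σℚ (map f xs)             ≡⟨ cong₂ _+_ px (Σℚ-const f ps) ⟩
  c + ℕ→ℚ (length xs) * c         ≡⟨ solve 2 (λ c n → c :+ n :* c := (con 1ℚ :+ n) :* c) refl c (ℕ→ℚ (length xs)) ⟩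
  (1ℚ + ℕ→ℚ (length xs)) * c      ≡⟨ cong (_* c) (ℕ→ℚ-+ 1 (length xs)) ⟨
  ℕ→ℚ (suc (length xs)) * c       ∎
  where open ≡-Reasoning

-- The second factor of `z` with a free cut-off: in `z` the cut-off depends on the sum of the list
-- and moves when a part is added.
factorials : ℕ → List ℕ → ℕ
factorials n l = product (map (λ i → count i l !) (upTo n))

factorials-suc : ∀ n l → factorials (suc n) l ≡ factorials n l ℕ.* (count n l !)
factorials-suc n l = begin
  product (map f (upTo (suc n)))              ≡⟨ cong (λ xs → product (map f xs)) (upTo-∷ʳ n) ⟨
  product (map f (upTo n ++ n ∷ []))          ≡⟨ cong product (map-++ f (upTo n) (n ∷ [])) ⟩
  product (map f (upTo n) ++ f n ∷ [])        ≡⟨ product-++ (map f (upTo n)) (f n ∷ []) ⟩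
  product (map f (upTo n)) ℕ.* (f n ℕ.* 1)    ≡⟨ cong (product (map f (upTo n)) ℕ.*_) (ℕₚ.*-identityʳ (f n)) ⟩
  product (map f (upTo n)) ℕ.* f n            ∎
  where
  open ≡-Reasoning
  f : ℕ → ℕ
  f i = count i l !

count-> : ∀ i l → sum l ℕ.< i → count i l ≡ 0
count-> i []      _   = refl
count-> i (x ∷ l) l<i = trans
  (count-diff l λ i≡x → ℕₚ.<⇒≱ l<i (ℕₚ.≤-trans (ℕₚ.≤-reflexive i≡x) (ℕₚ.m≤m+n x (sum l))))
  (count-> i l (ℕₚ.≤-<-trans (ℕₚ.m≤n+m (sum l) x) l<i))

factorials-extend : ∀ k l → factorials (k ℕ.+ suc (sum l)) l ≡ factorials (suc (sum l)) l
factorials-extend zero    l = refl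
factorials-extend (suc k) l = begin
  factorials (suc (k ℕ.+ suc (sum l))) l
    ≡⟨ factorials-suc (k ℕ.+ suc (sum l)) l ⟩
  factorials (k ℕ.+ suc (sum l)) l ℕ.* (count (k ℕ.+ suc (sum l)) l !)
    ≡⟨ cong₂ (λ a b → a ℕ.* (b !)) (factorials-extend k l) (count-> (k ℕ.+ suc (sum l)) l (ℕₚ.m≤n+m (suc (sum l)) k)) ⟩
  factorials (suc (sum l)) l ℕ.* 1
    ≡⟨ ℕₚ.*-identityʳ _ ⟩
  factorials (suc (sum l)) l ∎
  where open ≡-Reasoning

factorials-≤ : ∀ n j l → n ℕ.≤ j → factorials n (j ∷ l) ≡ factorials n l
factorials-≤ zero    j l _   = refl
factorials-≤ (suc n) j l n<j = begin
  factorials (suc n) (j ∷ l)                           ≡⟨ factorials-suc n (j ∷ l) ⟩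
  factorials n (j ∷ l) ℕ.* (count n (j ∷ l) !)         ≡⟨ cong₂ (λ a b → a ℕ.* (b !)) (factorials-≤ n j l (ℕₚ.<⇒≤ n<j)) (count-diff l (ℕₚ.<⇒≢ n<j)) ⟩
  factorials n l ℕ.* (count n l !)                     ≡⟨ factorials-suc n l ⟨
  factorials (suc n) l                                 ∎
  where open ≡-Reasoning

-- Only the factor of index j changes, from c! to (c + 1)!.
factorials-> : ∀ n j l → j ℕ.< n → factorials n (j ∷ l) ≡ suc (count j l) ℕ.* factorials n l
factorials-> (suc n) j l (s≤s j≤n) with ℕₚ.m≤n⇒m<n∨m≡n j≤n
... | inj₁ j<n = begin
  factorials (suc n) (j ∷ l)                              ≡⟨ factorials-suc n (j ∷ l) ⟩
  factorials n (j ∷ l) ℕ.* (count n (j ∷ l) !)            ≡⟨ cong₂ (λ a b → a ℕ.* (b !)) (factorials-> n j l j<n) (count-diff l λ n≡j → ℕₚ.<⇒≢ j<n (sym n≡j)) ⟩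
  suc (count j l) ℕ.* factorials n l ℕ.* (count n l !)    ≡⟨ ℕₚ.*-assoc (suc (count j l)) (factorials n l) _ ⟩
  suc (count j l) ℕ.* (factorials n l ℕ.* (count n l !))  ≡⟨ cong (suc (count j l) ℕ.*_) (factorials-suc n l) ⟨
  suc (count j l) ℕ.* factorials (suc n) l                ∎
  where open ≡-Reasoning
... | inj₂ refl = begin
  factorials (suc j) (j ∷ l)                              ≡⟨ factorials-suc j (j ∷ l) ⟩
  factorials j (j ∷ l) ℕ.* (count j (j ∷ l) !)            ≡⟨ cong₂ (λ a b → a ℕ.* (b !)) (factorials-≤ j j l ℕₚ.≤-refl) (count-same j l) ⟩
  factorials j l ℕ.* (suc (count j l) ℕ.* (count j l !))  ≡⟨ x*[y*z] (factorials j l) (suc (count j l)) (count j l !) ⟩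
  suc (count j l) ℕ.* (factorials j l ℕ.* (count j l !))  ≡⟨ cong (suc (count j l) ℕ.*_) (factorials-suc j l) ⟨
  suc (count j l) ℕ.* factorials (suc j) l                ∎
  where
  open ≡-Reasoning
  x*[y*z] : ∀ x y z → x ℕ.* (y ℕ.* z) ≡ y ℕ.* (x ℕ.* z)
  x*[y*z] = ℕ-Ring.solve-∀

z-∷ : ∀ j l → z (j ∷ l) ≡ j ℕ.* (suc (count j l) ℕ.* z l)
z-∷ j l = begin
  j ℕ.* product l ℕ.* factorials (suc (j ℕ.+ sum l)) (j ∷ l)
    ≡⟨ cong (j ℕ.* product l ℕ.*_) (factorials-> (suc (j ℕ.+ sum l)) j l (s≤s (ℕₚ.m≤m+n j (sum l)))) ⟩
  j ℕ.* product l ℕ.* (suc (count j l) ℕ.* factorials (suc (j ℕ.+ sum l)) l)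
    ≡⟨ cong (λ x → j ℕ.* product l ℕ.* (suc (count j l) ℕ.* x)) (trans (cong (λ n → factorials n l) (sym (ℕₚ.+-suc j (sum l)))) (factorials-extend j l)) ⟩
  j ℕ.* product l ℕ.* (suc (count j l) ℕ.* factorials (suc (sum l)) l)
    ≡⟨ rearrange j (product l) (suc (count j l)) (factorials (suc (sum l)) l) ⟩
  j ℕ.* (suc (count j l) ℕ.* z l) ∎
  where
  open ≡-Reasoning
  rearrange : ∀ a b c d → a ℕ.* b ℕ.* (c ℕ.* d) ≡ a ℕ.* (c ℕ.* (b ℕ.* d))
  rearrange = ℕ-Ring.solve-∀

-- Multiplication by p_j is adjoint to the derivation j ∂/∂p_j.
pInner-∷ : ∀ j l m → pInner (j ∷ l) m ≡ ℕ→ℚ j * Σℚ (map (pInner l) (removals j m))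
pInner-∷ j l m with sameCounts? (j ∷ l) m
... | yes same = begin
  pInner (j ∷ l) m                                             ≡⟨ pInner-same (j ∷ l) m same ⟩
  ℕ→ℚ (z (j ∷ l))                                              ≡⟨ cong ℕ→ℚ (z-∷ j l) ⟩
  ℕ→ℚ (j ℕ.* (suc (count j l) ℕ.* z l))                        ≡⟨ ℕ→ℚ-* j _ ⟩
  ℕ→ℚ j * ℕ→ℚ (suc (count j l) ℕ.* z l)                        ≡⟨ cong (ℕ→ℚ j *_) (ℕ→ℚ-* (suc (count j l)) (z l)) ⟩
  -- The multiplicity of j in m is the number of removals, and each removal is l as a multiset.
  ℕ→ℚ j * (ℕ→ℚ (suc (count j l)) * ℕ→ℚ (z l))                  ≡⟨ cong (λ n → ℕ→ℚ j * (ℕ→ℚ n * ℕ→ℚ (z l))) (trans (sym (count-same j l)) (trans (same j) (sym (length-removals j m)))) ⟩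
  ℕ→ℚ j * (ℕ→ℚ (length (removals j m)) * ℕ→ℚ (z l))            ≡⟨ cong (ℕ→ℚ j *_) (Σℚ-const (pInner l) all-z) ⟨
  ℕ→ℚ j * Σℚ (map (pInner l) (removals j m))                   ∎
  where
  open ≡-Reasoning
  all-z : All (λ r → pInner l r ≡ ℕ→ℚ (z l)) (removals j m)
  all-z = All.map (λ {r} e → pInner-same l r λ i → count-cancel i j l r (trans (same i) (sym (e i)))) (removals-counts j m)
... | no differ = begin
  pInner (j ∷ l) m                                             ≡⟨ pInner-differ (j ∷ l) m differ ⟩
  0ℚ                                                           ≡⟨ *-zeroʳ (ℕ→ℚ j) ⟨
  ℕ→ℚ j * 0ℚ                                                   ≡⟨ cong (ℕ→ℚ j *_) (*-zeroʳ (ℕ→ℚ (length (removals j m)))) ⟨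
  ℕ→ℚ j * (ℕ→ℚ (length (removals j m)) * 0ℚ)                   ≡⟨ cong (ℕ→ℚ j *_) (Σℚ-const (pInner l) all-0) ⟨
  ℕ→ℚ j * Σℚ (map (pInner l) (removals j m))                   ∎
  where
  open ≡-Reasoning
  all-0 : All (λ r → pInner l r ≡ 0ℚ) (removals j m)
  all-0 = All.map (λ {r} e → pInner-differ l r λ same → differ λ i → trans (count-cong i j l r (same i)) (e i)) (removals-counts j m)

⟨p_,p⟩ : List ℕ → WordFn
⟨p m ,p⟩ l = pInner (map suc l) m

⟨p⟩-∷ : ∀ i l m → ⟨p m ,p⟩ (i ∷ l) ≡ ℕ→ℚ (suc i) * Σℚ (map (λ r → ⟨p r ,p⟩ l) (removals (suc i) m))
⟨p⟩-∷ i l m = pInner-∷ (suc i) (map suc l) m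

map-∷-++ : ∀ (x : ℕ) m ms m' ms' {rs} → rs ≡ map (_++ m') ms ++ map (m ++_) ms' →
  map (x ∷_) rs ≡ map (_++ m') (map (x ∷_) ms) ++ map ((x ∷ m) ++_) ms'
map-∷-++ x m ms m' ms' refl = trans (map-++ (x ∷_) (map (_++ m') ms) (map (m ++_) ms'))
  (cong₂ _++_ (trans (sym (map-∘ ms)) (map-∘ ms)) (sym (map-∘ ms')))

removals-++ : ∀ j m m' → removals j (m ++ m') ≡ map (_++ m') (removals j m) ++ map (m ++_) (removals j m')
removals-++ j []      m' = sym (map-id (removals j m'))
removals-++ j (x ∷ m) m' with ⌊ j ℕ.≟ x ⌋
... | true  = cong ((m ++ m') ∷_) (map-∷-++ x m (removals j m) m' (removals j m') (removals-++ j m m'))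
... | false = map-∷-++ x m (removals j m) m' (removals j m') (removals-++ j m m')

⧢-Σˡ : ∀ (F : List ℕ → WordFn) G l rs →
  ((λ k → Σℚ (map (λ r → F r k) rs)) ⧢ G) l ≡ Σℚ (map (λ r → (F r ⧢ G) l) rs)
⧢-Σˡ F G l []       = ⧢-zeroˡ G l
⧢-Σˡ F G l (r ∷ rs) = trans (⧢-distribʳ (F r) _ G l) (cong ((F r ⧢ G) l +_) (⧢-Σˡ F G l rs))

⧢-Σʳ : ∀ G (F : List ℕ → WordFn) l rs →
  (G ⧢ (λ k → Σℚ (map (λ r → F r k) rs))) l ≡ Σℚ (map (λ r → (G ⧢ F r) l) rs)
⧢-Σʳ G F l rs = trans (⧢-comm G _ l) (trans (⧢-Σˡ F G l rs)
  (cong Σℚ (map-cong (λ r → ⧢-comm (F r) G l) rs)))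

⟨p∷⟩[] : ∀ x m → ⟨p x ∷ m ,p⟩ [] ≡ 0ℚ
⟨p∷⟩[] x m = pInner-differ [] (x ∷ m) λ same → ℕₚ.0≢1+n (trans (same x) (count-same x m))

-- A part removed from m ++ m' comes from m or from m': the product rule for ∂ / ∂ p_j, which is the
-- shuffle recursion on the word l.
⟨p⟩-++ : ∀ l m m' → ⟨p m ++ m' ,p⟩ l ≡ (⟨p m ,p⟩ ⧢ ⟨p m' ,p⟩) l
⟨p⟩-++ []      []      m'      = sym (*-identityˡ (⟨p m' ,p⟩ []))
⟨p⟩-++ []      (x ∷ m) m'      = begin
  ⟨p x ∷ m ++ m' ,p⟩ []                ≡⟨ ⟨p∷⟩[] x (m ++ m') ⟩
  0ℚ                                   ≡⟨ *-zeroˡ (⟨p m' ,p⟩ []) ⟨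
  0ℚ * ⟨p m' ,p⟩ []                    ≡⟨ cong (_* ⟨p m' ,p⟩ []) (⟨p∷⟩[] x m) ⟨
  ⟨p x ∷ m ,p⟩ [] * ⟨p m' ,p⟩ []       ∎
  where
  open ≡-Reasoning
⟨p⟩-++ (i ∷ l) m m' = begin
  ⟨p m ++ m' ,p⟩ (i ∷ l)
    ≡⟨ ⟨p⟩-∷ i l (m ++ m') ⟩
  c * Σℚ (map φ (removals (suc i) (m ++ m')))
    ≡⟨ cong (λ rs → c * Σℚ (map φ rs)) (removals-++ (suc i) m m') ⟩
  c * Σℚ (map φ (map (_++ m') rs ++ map (m ++_) rs'))
    ≡⟨ cong (λ xs → c * Σℚ xs) (trans (map-++ φ (map (_++ m') rs) _) (cong₂ _++_ (sym (map-∘ rs)) (sym (map-∘ rs')))) ⟩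
  c * Σℚ (map (λ r → φ (r ++ m')) rs ++ map (λ r → φ (m ++ r)) rs')
    ≡⟨ cong (c *_) (Σℚ-++ (map (λ r → φ (r ++ m')) rs) _) ⟩
  c * (Σℚ (map (λ r → φ (r ++ m')) rs) + Σℚ (map (λ r → φ (m ++ r)) rs'))
    ≡⟨ cong (c *_) (cong₂ (λ xs ys → Σℚ xs + Σℚ ys)
         (map-cong (λ r → ⟨p⟩-++ l r m') rs)
         (map-cong (λ r → ⟨p⟩-++ l m r) rs')) ⟩
  c * (Σℚ (map (λ r → (⟨p r ,p⟩ ⧢ ⟨p m' ,p⟩) l) rs) + Σℚ (map (λ r → (⟨p m ,p⟩ ⧢ ⟨p r ,p⟩) l) rs'))
    ≡⟨ *-distribˡ-+ c _ _ ⟩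
  c * Σℚ (map (λ r → (⟨p r ,p⟩ ⧢ ⟨p m' ,p⟩) l) rs) + c * Σℚ (map (λ r → (⟨p m ,p⟩ ⧢ ⟨p r ,p⟩) l) rs')
    ≡⟨ cong₂ (λ x y → c * x + c * y) (⧢-Σˡ ⟨p_,p⟩ ⟨p m' ,p⟩ l rs) (⧢-Σʳ ⟨p m ,p⟩ ⟨p_,p⟩ l rs') ⟨
  c * ((λ k → Σℚ (map (λ r → ⟨p r ,p⟩ k) rs)) ⧢ ⟨p m' ,p⟩) l + c * (⟨p m ,p⟩ ⧢ (λ k → Σℚ (map (λ r → ⟨p r ,p⟩ k) rs'))) l
    ≡⟨ cong₂ _+_ (⧢-scaleˡ c _ ⟨p m' ,p⟩ l) (⧢-scaleʳ c ⟨p m ,p⟩ _ l) ⟨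
  ((λ k → c * Σℚ (map (λ r → ⟨p r ,p⟩ k) rs)) ⧢ ⟨p m' ,p⟩) l + (⟨p m ,p⟩ ⧢ (λ k → c * Σℚ (map (λ r → ⟨p r ,p⟩ k) rs'))) l
    ≡⟨ cong₂ _+_ (⧢-congʳ (λ k → ⟨p⟩-∷ i k m) l) (⧢-congˡ (λ k → ⟨p⟩-∷ i k m') l) ⟨
  (⟨p m ,p⟩ ⧢ ⟨p m' ,p⟩) (i ∷ l) ∎
  where
  open ≡-Reasoning
  c = ℕ→ℚ (suc i)
  φ : List ℕ → ℚ
  φ r = ⟨p r ,p⟩ l
  rs  = removals (suc i) m
  rs' = removals (suc i) m'

-- The functional of an arbitrary symmetric function

ev : Sym → WordFn
ev []            l = 0ℚ
ev ((d , m) ∷ g) l = d * ⟨p m ,p⟩ l + ev g l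

ev-++ : ∀ f g l → ev (f ++ g) l ≡ ev f l + ev g l
ev-++ []            g l = sym (+-identityˡ (ev g l))
ev-++ ((d , m) ∷ f) g l = trans (cong (d * ⟨p m ,p⟩ l +_) (ev-++ f g l)) (sym (+-assoc (d * ⟨p m ,p⟩ l) (ev f l) (ev g l)))

ev-scale : ∀ a g l → ev (scaleS a g) l ≡ a * ev g l
ev-scale a []            l = sym (*-zeroʳ a)
ev-scale a ((d , m) ∷ g) l = trans (cong (a * d * ⟨p m ,p⟩ l +_) (ev-scale a g l))
  (solve 4 (λ a d p e → a :* d :* p :+ a :* e := a :* (d :* p :+ e)) refl a d (⟨p m ,p⟩ l) (ev g l))

times : ℚ → List ℕ → ℚ × List ℕ → ℚ × List ℕ
times c m (d , k) = c * d , m ++ k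

ev-times : ∀ c m g l → ev (map (times c m) g) l ≡ ((λ k → c * ⟨p m ,p⟩ k) ⧢ ev g) l
ev-times c m []            l = sym (trans (⧢-comm _ (λ _ → 0ℚ) l) (⧢-zeroˡ _ l))
ev-times c m ((d , k) ∷ g) l = begin
  c * d * ⟨p m ++ k ,p⟩ l + ev (map (times c m) g) l
    ≡⟨ cong₂ _+_ (cong (c * d *_) (⟨p⟩-++ l m k)) (ev-times c m g l) ⟩
  c * d * (⟨p m ,p⟩ ⧢ ⟨p k ,p⟩) l + (cm ⧢ ev g) l
    ≡⟨ cong (_+ (cm ⧢ ev g) l) (trans (cong (_* (⟨p m ,p⟩ ⧢ ⟨p k ,p⟩) l) (*-comm c d)) (*-assoc d c ((⟨p m ,p⟩ ⧢ ⟨p k ,p⟩) l))) ⟩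
  d * (c * (⟨p m ,p⟩ ⧢ ⟨p k ,p⟩) l) + (cm ⧢ ev g) l
    ≡⟨ cong (λ x → d * x + (cm ⧢ ev g) l) (⧢-scaleˡ c ⟨p m ,p⟩ ⟨p k ,p⟩ l) ⟨
  d * (cm ⧢ ⟨p k ,p⟩) l + (cm ⧢ ev g) l
    ≡⟨ cong (_+ (cm ⧢ ev g) l) (⧢-scaleʳ d cm ⟨p k ,p⟩ l) ⟨
  (cm ⧢ (λ j → d * ⟨p k ,p⟩ j)) l + (cm ⧢ ev g) l
    ≡⟨ ⧢-distribˡ cm (λ j → d * ⟨p k ,p⟩ j) (ev g) l ⟨
  (cm ⧢ ev ((d , k) ∷ g)) l ∎
  where
  open ≡-Reasoning
  cm : WordFn
  cm j = c * ⟨p m ,p⟩ j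

ev-mul : ∀ f g l → ev (mulS f g) l ≡ (ev f ⧢ ev g) l
ev-mul []            g l = sym (⧢-zeroˡ (ev g) l)
ev-mul ((c , m) ∷ f) g l = begin
  ev (mulS ((c , m) ∷ f) g) l
    ≡⟨ ev-++ (map (times c m) g) (mulS f g) l ⟩
  ev (map (times c m) g) l + ev (mulS f g) l
    ≡⟨ cong₂ _+_ (ev-times c m g l) (ev-mul f g l) ⟩
  ((λ k → c * ⟨p m ,p⟩ k) ⧢ ev g) l + (ev f ⧢ ev g) l
    ≡⟨ ⧢-distribʳ (λ k → c * ⟨p m ,p⟩ k) (ev f) (ev g) l ⟨
  (ev ((c , m) ∷ f) ⧢ ev g) l ∎
  where open ≡-Reasoning

-- Complete homogeneous functions and ribbons

⟨p[]⟩ : ∀ l → ⟨p [] ,p⟩ l ≡ H 0 l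
⟨p[]⟩ []      = refl
⟨p[]⟩ (i ∷ l) = trans (⟨p⟩-∷ i l []) (*-zeroʳ (ℕ→ℚ (suc i)))

ev-one : ∀ l → ev oneS l ≡ H 0 l
ev-one l = trans (+-identityʳ _) (trans (*-identityˡ _) (⟨p[]⟩ l))

-- The functional of p_{j+1}, supported on the one-letter word j with value z = j + 1.
P : ℕ → WordFn
P j []      = 0ℚ
P j (a ∷ l) = δ j a * ℕ→ℚ (suc a) * H 0 l

ev-p : ∀ j l → ev (pS (suc j)) l ≡ P j l
ev-p j l = trans (+-identityʳ (1ℚ * ⟨p suc j ∷ [] ,p⟩ l)) (trans (*-identityˡ (⟨p suc j ∷ [] ,p⟩ l)) (lemma l))
  where
  open ≡-Reasoning
  lemma : ∀ l → ⟨p suc j ∷ [] ,p⟩ l ≡ P j l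
  lemma []      = ⟨p∷⟩[] (suc j) []
  lemma (a ∷ l) = begin
    ⟨p suc j ∷ [] ,p⟩ (a ∷ l)
      ≡⟨ ⟨p⟩-∷ a l (suc j ∷ []) ⟩
    ℕ→ℚ (suc a) * Σℚ (map (λ r → ⟨p r ,p⟩ l) (removals (suc a) (suc j ∷ [])))
      ≡⟨ cong (ℕ→ℚ (suc a) *_) sum≡ ⟩
    ℕ→ℚ (suc a) * (δ j a * H 0 l)
      ≡⟨ solve 3 (λ n d h → n :* (d :* h) := d :* n :* h) refl (ℕ→ℚ (suc a)) (δ j a) (H 0 l) ⟩
    δ j a * ℕ→ℚ (suc a) * H 0 l ∎
    where
    sum≡ : Σℚ (map (λ r → ⟨p r ,p⟩ l) (removals (suc a) (suc j ∷ []))) ≡ δ j a * H 0 l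
    sum≡ with suc a ℕ.≟ suc j
    ... | yes refl = begin
      ⟨p [] ,p⟩ l + 0ℚ   ≡⟨ +-identityʳ _ ⟩
      ⟨p [] ,p⟩ l        ≡⟨ ⟨p[]⟩ l ⟩
      H 0 l              ≡⟨ *-identityˡ (H 0 l) ⟨
      1ℚ * H 0 l         ≡⟨ cong (_* H 0 l) (δ-refl a) ⟨
      δ a a * H 0 l      ∎
    ... | no a≢j = begin
      0ℚ                 ≡⟨ *-zeroˡ (H 0 l) ⟨
      0ℚ * H 0 l         ≡⟨ cong (_* H 0 l) (δ-≢ j a λ j≡a → a≢j (cong suc (sym j≡a))) ⟨
      δ j a * H 0 l      ∎

∂P⧢ : ∀ a j G l → (∂ a (P j) ⧢ G) l ≡ δ j a * ℕ→ℚ (suc a) * G l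
∂P⧢ a j G l = trans (⧢-scaleˡ (δ j a * ℕ→ℚ (suc a)) (H 0) G l)
  (cong (δ j a * ℕ→ℚ (suc a) *_) (⧢-identityˡ G l))

-- The sum of P (j + i) ⧢ G (k - i) over i ≤ k. The family G is left free so that it can be
-- differentiated inside the sum.
newtonSum : (ℕ → WordFn) → ℕ → ℕ → WordFn
newtonSum G j zero    l = (P j ⧢ G 0) l
newtonSum G j (suc k) l = (P j ⧢ G (suc k)) l + newtonSum G (suc j) k l

newtonSum-cong : ∀ {G G'} → (∀ k l → G k l ≡ G' k l) → ∀ j k l → newtonSum G j k l ≡ newtonSum G' j k l
newtonSum-cong e j zero    l = ⧢-congˡ (e 0) l
newtonSum-cong e j (suc k) l = cong₂ _+_ (⧢-congˡ (e (suc k)) l) (newtonSum-cong e (suc j) k l)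

newtonSum-[] : ∀ G j k → newtonSum G j k [] ≡ 0ℚ
newtonSum-[] G j zero    = *-zeroˡ (G 0 [])
newtonSum-[] G j (suc k) = cong₂ _+_ (*-zeroˡ (G (suc k) [])) (newtonSum-[] G (suc j) k)

δ-conv : ℕ → ℕ → ℕ → ℕ → ℚ
δ-conv j zero    a x = δ j a * δ 0 x
δ-conv j (suc k) a x = δ j a * δ (suc k) x + δ-conv (suc j) k a x

δ-conv-zero : ∀ j k x → δ-conv (suc j) k 0 x ≡ 0ℚ
δ-conv-zero j zero    x = *-zeroˡ (δ 0 x)
δ-conv-zero j (suc k) x = cong₂ _+_ (*-zeroˡ (δ (suc k) x)) (δ-conv-zero (suc j) k x)

δ-conv-suc : ∀ j k a x → δ-conv (suc j) k (suc a) x ≡ δ-conv j k a x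
δ-conv-suc j zero    a x = refl
δ-conv-suc j (suc k) a x = cong (δ j a * δ (suc k) x +_) (δ-conv-suc (suc j) k a x)

δ-conv-δ : ∀ k a x → δ-conv 0 k a x ≡ δ k (a ℕ.+ x)
δ-conv-δ zero    zero    x = *-identityˡ (δ 0 x)
δ-conv-δ zero    (suc a) x = *-zeroˡ (δ 0 x)
δ-conv-δ (suc k) zero    x = trans (cong₂ _+_ (*-identityˡ (δ (suc k) x)) (δ-conv-zero 0 k x)) (+-identityʳ _)
δ-conv-δ (suc k) (suc a) x = trans
  (cong₂ _+_ (*-zeroˡ (δ (suc k) x)) (trans (δ-conv-suc 0 k a x) (δ-conv-δ k a x)))
  (+-identityˡ _)

Hˢ : ℕ → ℕ → WordFn
Hˢ s k l = δ k (s ℕ.+ size l)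

-- Product rule: the letter a either meets its power sum, which yields a + 1 and selects one term of
-- the sum, or differentiates the h factors.
newtonSum-∷ : ∀ s j k a l → newtonSum (Hˢ s) j k (a ∷ l) ≡
  ℕ→ℚ (suc a) * δ-conv j k a (s ℕ.+ size l) + newtonSum (λ i → ∂ a (Hˢ s i)) j k l
newtonSum-∷ s j zero    a l = cong (_+ (P j ⧢ ∂ a (Hˢ s 0)) l)
  (trans (∂P⧢ a j (Hˢ s 0) l)
    (solve 3 (λ d n h → d :* n :* h := n :* (d :* h)) refl (δ j a) (ℕ→ℚ (suc a)) (Hˢ s 0 l)))
newtonSum-∷ s j (suc k) a l = begin
  ((∂ a (P j) ⧢ Hˢ s (suc k)) l + (P j ⧢ ∂ a (Hˢ s (suc k))) l) + newtonSum (Hˢ s) (suc j) k (a ∷ l)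
    ≡⟨ cong₂ (λ x y → (x + (P j ⧢ ∂ a (Hˢ s (suc k))) l) + y) (∂P⧢ a j (Hˢ s (suc k)) l) (newtonSum-∷ s (suc j) k a l) ⟩
  (δ j a * ℕ→ℚ (suc a) * Hˢ s (suc k) l + (P j ⧢ ∂ a (Hˢ s (suc k))) l)
    + (ℕ→ℚ (suc a) * δ-conv (suc j) k a (s ℕ.+ size l) + newtonSum (λ i → ∂ a (Hˢ s i)) (suc j) k l)
    ≡⟨ solve 6 (λ d n h p c m → (d :* n :* h :+ p) :+ (n :* c :+ m) := n :* (d :* h :+ c) :+ (p :+ m)) refl
         (δ j a) (ℕ→ℚ (suc a)) (Hˢ s (suc k) l) ((P j ⧢ ∂ a (Hˢ s (suc k))) l)
         (δ-conv (suc j) k a (s ℕ.+ size l)) (newtonSum (λ i → ∂ a (Hˢ s i)) (suc j) k l) ⟩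
  ℕ→ℚ (suc a) * δ-conv j (suc k) a (s ℕ.+ size l) + newtonSum (λ i → ∂ a (Hˢ s i)) j (suc k) l ∎
  where open ≡-Reasoning

-- Newton's identity, with the argument of h shifted by s to make the induction go through.
newtonSum-H : ∀ s k l → newtonSum (Hˢ s) 0 k l ≡ ℕ→ℚ (size l) * δ (suc k) (s ℕ.+ size l)
newtonSum-H s k []      = trans (newtonSum-[] (Hˢ s) 0 k) (sym (*-zeroˡ (δ (suc k) (s ℕ.+ 0))))
newtonSum-H s k (a ∷ l) = begin
  newtonSum (Hˢ s) 0 k (a ∷ l)
    ≡⟨ newtonSum-∷ s 0 k a l ⟩
  ℕ→ℚ (suc a) * δ-conv 0 k a (s ℕ.+ size l) + newtonSum (λ i → ∂ a (Hˢ s i)) 0 k l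
    ≡⟨ cong₂ (λ x y → ℕ→ℚ (suc a) * x + y)
         (trans (δ-conv-δ k a (s ℕ.+ size l)) (cong (δ (suc k)) swap))
         (trans (newtonSum-cong (λ i m → cong (δ i) (sym (ℕₚ.+-assoc s (suc a) (size m)))) 0 k l)
           (trans (newtonSum-H (s ℕ.+ suc a) k l) (cong (λ x → ℕ→ℚ (size l) * δ (suc k) x) (ℕₚ.+-assoc s (suc a) (size l))))) ⟩
  -- Each letter contributes its own degree, so the factor k in Newton's identity appears as the
  -- total degree of the word.
  ℕ→ℚ (suc a) * d + ℕ→ℚ (size l) * d
    ≡⟨ *-distribʳ-+ d (ℕ→ℚ (suc a)) (ℕ→ℚ (size l)) ⟨
  (ℕ→ℚ (suc a) + ℕ→ℚ (size l)) * d
    ≡⟨ cong (_* d) (ℕ→ℚ-+ (suc a) (size l)) ⟨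
  ℕ→ℚ (suc a ℕ.+ size l) * d ∎
  where
  open ≡-Reasoning
  d = δ (suc k) (s ℕ.+ (suc a ℕ.+ size l))
  swap : suc a ℕ.+ (s ℕ.+ size l) ≡ s ℕ.+ (suc a ℕ.+ size l)
  swap = trans (sym (ℕₚ.+-assoc (suc a) s (size l)))
    (trans (cong (ℕ._+ size l) (ℕₚ.+-comm (suc a) s)) (ℕₚ.+-assoc s (suc a) (size l)))

invSuc-δ : ∀ k n → invSuc k * (ℕ→ℚ n * δ (suc k) n) ≡ δ (suc k) n
invSuc-δ k n with suc k ℕ.≟ n
... | yes refl = begin
  invSuc k * (ℕ→ℚ (suc k) * δ (suc k) (suc k))
    ≡⟨ solve 3 (λ i n d → i :* (n :* d) := (n :* i) :* d) refl (invSuc k) (ℕ→ℚ (suc k)) (δ k k) ⟩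
  (ℕ→ℚ (suc k) * invSuc k) * δ k k
    ≡⟨ cong (_* δ k k) (ℕ→ℚ-invSuc k) ⟩
  1ℚ * δ k k
    ≡⟨ *-identityˡ (δ k k) ⟩
  δ k k ∎
  where open ≡-Reasoning
... | no k≢n rewrite δ-≢ (suc k) n k≢n = trans (cong (invSuc k *_) (*-zeroʳ (ℕ→ℚ n))) (*-zeroʳ (invSuc k))

mutual
  ev-h : ∀ k l → ev (hS k) l ≡ H k l
  ev-h zero    l = ev-one l
  ev-h (suc k) l = begin
    ev (scaleS (invSuc k) (newton 0 (hRev k))) l       ≡⟨ ev-scale (invSuc k) (newton 0 (hRev k)) l ⟩
    invSuc k * ev (newton 0 (hRev k)) l                ≡⟨ cong (invSuc k *_) (ev-newton 0 k l) ⟩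
    invSuc k * newtonSum H 0 k l                       ≡⟨ cong (invSuc k *_) (newtonSum-H 0 k l) ⟩
    invSuc k * (ℕ→ℚ (size l) * δ (suc k) (size l))     ≡⟨ invSuc-δ k (size l) ⟩
    H (suc k) l                                        ∎
    where open ≡-Reasoning

  ev-newton : ∀ j k l → ev (newton j (hRev k)) l ≡ newtonSum H j k l
  ev-newton j zero    l = begin
    ev (mulS (pS (suc j)) oneS ++ []) l          ≡⟨ ev-++ (mulS (pS (suc j)) oneS) [] l ⟩
    ev (mulS (pS (suc j)) oneS) l + 0ℚ           ≡⟨ +-identityʳ _ ⟩
    ev (mulS (pS (suc j)) oneS) l                ≡⟨ ev-mul (pS (suc j)) oneS l ⟩
    (ev (pS (suc j)) ⧢ ev oneS) l                ≡⟨ ⧢-cong (ev-p j) ev-one l ⟩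
    (P j ⧢ H 0) l                                ∎
    where open ≡-Reasoning
  ev-newton j (suc k) l = begin
    ev (mulS (pS (suc j)) (hS (suc k)) ++ newton (suc j) (hRev k)) l
      ≡⟨ ev-++ (mulS (pS (suc j)) (hS (suc k))) (newton (suc j) (hRev k)) l ⟩
    ev (mulS (pS (suc j)) (hS (suc k))) l + ev (newton (suc j) (hRev k)) l
      ≡⟨ cong₂ _+_ (trans (ev-mul (pS (suc j)) (hS (suc k)) l) (⧢-cong (ev-p j) (ev-h (suc k)) l)) (ev-newton (suc j) k l) ⟩
    newtonSum H j (suc k) l ∎
    where open ≡-Reasoning

-- `ribbon` with the number of rows as a free parameter n: merging two rows shortens the composition
-- while the signs still refer to the original length.
signedSum : ℕ → List (List ℕ) → Sym
signedSum n βs = sumS (map (λ β → scaleS (sgn (n ℕ.∸ length β)) (prodS (map hS β))) βs)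

ev-signedSum-∷ : ∀ n β βs l → ev (signedSum n (β ∷ βs)) l ≡
  sgn (n ℕ.∸ length β) * ev (prodS (map hS β)) l + ev (signedSum n βs) l
ev-signedSum-∷ n β βs l = trans
  (ev-++ (scaleS (sgn (n ℕ.∸ length β)) (prodS (map hS β))) (signedSum n βs) l)
  (cong (_+ ev (signedSum n βs) l) (ev-scale (sgn (n ℕ.∸ length β)) (prodS (map hS β)) l))

ev-signedSum-++ : ∀ n βs γs l → ev (signedSum n (βs ++ γs)) l ≡ ev (signedSum n βs) l + ev (signedSum n γs) l
ev-signedSum-++ n []       γs l = sym (+-identityˡ (ev (signedSum n γs) l))
ev-signedSum-++ n (β ∷ βs) γs l = begin
  ev (signedSum n (β ∷ βs ++ γs)) l
    ≡⟨ ev-signedSum-∷ n β (βs ++ γs) l ⟩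
  t + ev (signedSum n (βs ++ γs)) l
    ≡⟨ cong (t +_) (ev-signedSum-++ n βs γs l) ⟩
  t + (ev (signedSum n βs) l + ev (signedSum n γs) l)
    ≡⟨ +-assoc t (ev (signedSum n βs) l) (ev (signedSum n γs) l) ⟨
  (t + ev (signedSum n βs) l) + ev (signedSum n γs) l
    ≡⟨ cong (_+ ev (signedSum n γs) l) (ev-signedSum-∷ n β βs l) ⟨
  ev (signedSum n (β ∷ βs)) l + ev (signedSum n γs) l ∎
  where
  open ≡-Reasoning
  t = sgn (n ℕ.∸ length β) * ev (prodS (map hS β)) l

-- Prepending a part raises both n and the length, so the signs are unchanged.
ev-signedSum-map : ∀ n a βs l → ev (signedSum (suc n) (map (a ∷_) βs)) l ≡ (H a ⧢ ev (signedSum n βs)) l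
ev-signedSum-map n a []       l = sym (trans (⧢-comm (H a) (λ _ → 0ℚ) l) (⧢-zeroˡ (H a) l))
ev-signedSum-map n a (β ∷ βs) l = begin
  ev (signedSum (suc n) ((a ∷ β) ∷ map (a ∷_) βs)) l
    ≡⟨ ev-signedSum-∷ (suc n) (a ∷ β) (map (a ∷_) βs) l ⟩
  c * ev (mulS (hS a) hβ) l + ev (signedSum (suc n) (map (a ∷_) βs)) l
    ≡⟨ cong₂ (λ x y → c * x + y) (trans (ev-mul (hS a) hβ l) (⧢-congʳ (ev-h a) l)) (ev-signedSum-map n a βs l) ⟩
  c * (H a ⧢ ev hβ) l + (H a ⧢ ev (signedSum n βs)) l
    ≡⟨ cong (_+ (H a ⧢ ev (signedSum n βs)) l) (⧢-scaleʳ c (H a) (ev hβ) l) ⟨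
  (H a ⧢ (λ k → c * ev hβ k)) l + (H a ⧢ ev (signedSum n βs)) l
    ≡⟨ ⧢-distribˡ (H a) (λ k → c * ev hβ k) (ev (signedSum n βs)) l ⟨
  (H a ⧢ (λ k → c * ev hβ k + ev (signedSum n βs) k)) l
    ≡⟨ ⧢-congˡ (ev-signedSum-∷ n β βs) l ⟨
  (H a ⧢ ev (signedSum n (β ∷ βs))) l ∎
  where
  open ≡-Reasoning
  c = sgn (n ℕ.∸ length β)
  hβ = prodS (map hS β)

-- One more row in the reference length flips every sign; the length bound keeps the truncated
-- subtraction exact.
ev-signedSum-suc : ∀ n {βs} → All (λ β → length β ≤ n) βs → ∀ l → ev (signedSum (suc n) βs) l ≡ - ev (signedSum n βs) l
ev-signedSum-suc n []                       l = refl
ev-signedSum-suc n {β ∷ βs} (β≤n ∷ βs≤n) l = begin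
  ev (signedSum (suc n) (β ∷ βs)) l
    ≡⟨ ev-signedSum-∷ (suc n) β βs l ⟩
  sgn (suc n ℕ.∸ length β) * x + ev (signedSum (suc n) βs) l
    ≡⟨ cong₂ (λ k y → sgn k * x + y) (ℕₚ.+-∸-assoc 1 β≤n) (ev-signedSum-suc n βs≤n l) ⟩
  (- c) * x + - ev (signedSum n βs) l
    ≡⟨ solve 3 (λ c x y → (:- c) :* x :+ (:- y) := :- (c :* x :+ y)) refl c x (ev (signedSum n βs) l) ⟩
  - (c * x + ev (signedSum n βs) l)
    ≡⟨ cong -_ (ev-signedSum-∷ n β βs l) ⟨
  - ev (signedSum n (β ∷ βs)) l ∎
  where
  open ≡-Reasoning
  c = sgn (n ℕ.∸ length β)
  x = ev (prodS (map hS β)) l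

coarsenings-length : ∀ a r → All (λ β → length β ≤ suc (length r)) (coarsenings (a ∷ r))
coarsenings-length a []      = s≤s z≤n ∷ []
coarsenings-length a (b ∷ r) = Allₚ.++⁺
  (Allₚ.map⁺ (All.map s≤s (coarsenings-length b r)))
  (All.map ℕₚ.m≤n⇒m≤1+n (coarsenings-length (a ℕ.+ b) r))

-- A coarsening of (a, b, r) keeps a as a separate part or merges it into a + b. The merged ones
-- have one row fewer to start from, hence the minus sign in `R`.
ev-ribbon : ∀ a r l → ev (ribbon (a ∷ r)) l ≡ R a r l
ev-ribbon a []      l = begin
  ev (signedSum 1 ((a ∷ []) ∷ [])) l               ≡⟨ ev-signedSum-map 0 a ([] ∷ []) l ⟩
  (H a ⧢ ev (signedSum 0 ([] ∷ []))) l             ≡⟨ ⧢-congˡ (λ k → trans (ev-signedSum-∷ 0 [] [] k) (trans (+-identityʳ (1ℚ * ev oneS k)) (trans (*-identityˡ (ev oneS k)) (ev-one k)))) l ⟩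
  (H a ⧢ H 0) l                                    ≡⟨ ⧢-comm (H a) (H 0) l ⟩
  (H 0 ⧢ H a) l                                    ≡⟨ ⧢-identityˡ (H a) l ⟩
  H a l                                            ∎
  where open ≡-Reasoning
ev-ribbon a (b ∷ r) l = begin
  ev (signedSum (suc n) (map (a ∷_) (coarsenings (b ∷ r)) ++ coarsenings (a ℕ.+ b ∷ r))) l
    ≡⟨ ev-signedSum-++ (suc n) (map (a ∷_) (coarsenings (b ∷ r))) (coarsenings (a ℕ.+ b ∷ r)) l ⟩
  ev (signedSum (suc n) (map (a ∷_) (coarsenings (b ∷ r)))) l + ev (signedSum (suc n) (coarsenings (a ℕ.+ b ∷ r))) l
    ≡⟨ cong₂ _+_ (ev-signedSum-map n a (coarsenings (b ∷ r)) l) (ev-signedSum-suc n (coarsenings-length (a ℕ.+ b) r) l) ⟩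
  (H a ⧢ ev (ribbon (b ∷ r))) l - ev (ribbon (a ℕ.+ b ∷ r)) l
    ≡⟨ cong₂ _-_ (⧢-congˡ (ev-ribbon b r) l) (ev-ribbon (a ℕ.+ b) r l) ⟩
  R a (b ∷ r) l ∎
  where
  open ≡-Reasoning
  n = suc (length r)

-- Euler numbers

cauchy : Seq → Seq → Seq
cauchy a b zero    = a 0 * b 0
cauchy a b (suc n) = a 0 * b (suc n) + cauchy (shift a) b n

cauchy-last : ∀ a b n → cauchy a b (suc n) ≡ cauchy a (shift b) n + a (suc n) * b 0
cauchy-last a b zero    = refl
cauchy-last a b (suc n) = trans (cong (a 0 * b (suc (suc n)) +_) (cauchy-last (shift a) b n))
  (sym (+-assoc (a 0 * b (suc (suc n))) (cauchy (shift a) (shift b) n) (a (suc (suc n)) * b 0)))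

cauchy-cong : ∀ {a a' b b'} → (∀ n → a n ≡ a' n) → (∀ n → b n ≡ b' n) → ∀ n → cauchy a b n ≡ cauchy a' b' n
cauchy-cong p q zero    = cong₂ _*_ (p 0) (q 0)
cauchy-cong p q (suc n) = cong₂ _+_ (cong₂ _*_ (p 0) (q (suc n))) (cauchy-cong (λ k → p (suc k)) q n)

weighted : ℕ → Seq → Seq
weighted r a n = ℕ→ℚ (r ℕ.+ n) * a n

-- The weight of a product splits over its two factors; r absorbs the shift of a in the recursion.
cauchy-weighted : ∀ r a b n →
  cauchy (weighted r a) b n + cauchy a (weighted 0 b) n ≡ ℕ→ℚ (r ℕ.+ n) * cauchy a b n
cauchy-weighted r a b zero    = solve 3 (λ r x y → r :* x :* y :+ x :* (con 0ℚ :* y) := r :* (x :* y)) refl (ℕ→ℚ (r ℕ.+ 0)) (a 0) (b 0)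
cauchy-weighted r a b (suc n) = begin
  (ℕ→ℚ (r ℕ.+ 0) * a 0 * b (suc n) + cauchy (shift (weighted r a)) b n)
    + (a 0 * (ℕ→ℚ (suc n) * b (suc n)) + cauchy (shift a) (weighted 0 b) n)
    ≡⟨ solve 6 (λ r x y m u v → (r :* x :* y :+ u) :+ (x :* (m :* y) :+ v) := (r :+ m) :* (x :* y) :+ (u :+ v)) refl
         (ℕ→ℚ (r ℕ.+ 0)) (a 0) (b (suc n)) (ℕ→ℚ (suc n)) (cauchy (shift (weighted r a)) b n) (cauchy (shift a) (weighted 0 b) n) ⟩
  (ℕ→ℚ (r ℕ.+ 0) + ℕ→ℚ (suc n)) * (a 0 * b (suc n))
    + (cauchy (shift (weighted r a)) b n + cauchy (shift a) (weighted 0 b) n)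
    ≡⟨ cong₂ (λ x y → x * (a 0 * b (suc n)) + y)
         (trans (sym (ℕ→ℚ-+ (r ℕ.+ 0) (suc n))) (cong (λ m → ℕ→ℚ (m ℕ.+ suc n)) (ℕₚ.+-identityʳ r)))
         (trans (cong (_+ cauchy (shift a) (weighted 0 b) n) (cauchy-cong (λ k → cong (λ m → ℕ→ℚ m * a (suc k)) (ℕₚ.+-suc r k)) (λ _ → refl) n))
           (trans (cauchy-weighted (suc r) (shift a) b n) (cong (λ m → ℕ→ℚ m * cauchy (shift a) b n) (sym (ℕₚ.+-suc r n))))) ⟩
  ℕ→ℚ (r ℕ.+ suc n) * (a 0 * b (suc n)) + ℕ→ℚ (r ℕ.+ suc n) * cauchy (shift a) b n
    ≡⟨ *-distribˡ-+ (ℕ→ℚ (r ℕ.+ suc n)) (a 0 * b (suc n)) (cauchy (shift a) b n) ⟨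
  ℕ→ℚ (r ℕ.+ suc n) * cauchy a b (suc n) ∎
  where open ≡-Reasoning

deriv : Seq → Seq
deriv a n = ℕ→ℚ (suc n) * a (suc n)

-- This is `cauchy-weighted` one degree higher, with the first term of one sum and the last term of
-- the other dropped: both carry weight 0.
cauchy-leibniz : ∀ a b n → deriv (cauchy a b) n ≡ cauchy (deriv a) b n + cauchy a (deriv b) n
cauchy-leibniz a b n = begin
  ℕ→ℚ (suc n) * cauchy a b (suc n)
    ≡⟨ cauchy-weighted 0 a b (suc n) ⟨
  (0ℚ * a 0 * b (suc n) + cauchy (deriv a) b n) + cauchy a (weighted 0 b) (suc n)
    ≡⟨ cong ((0ℚ * a 0 * b (suc n) + cauchy (deriv a) b n) +_) (cauchy-last a (weighted 0 b) n) ⟩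
  (0ℚ * a 0 * b (suc n) + cauchy (deriv a) b n) + (cauchy a (deriv b) n + a (suc n) * (0ℚ * b 0))
    ≡⟨ solve 6 (λ x y u v z w → (con 0ℚ :* x :* y :+ u) :+ (v :+ z :* (con 0ℚ :* w)) := u :+ v) refl
         (a 0) (b (suc n)) (cauchy (deriv a) b n) (cauchy a (deriv b) n) (a (suc n)) (b 0) ⟩
  cauchy (deriv a) b n + cauchy a (deriv b) n ∎
  where open ≡-Reasoning

egf : Seq → Seq
egf a n = ℕ→ℚ (n !) * a n

egf-suc : ∀ a n → egf a (suc n) ≡ egf (deriv a) n
egf-suc a n = trans (cong (_* a (suc n)) (ℕ→ℚ-* (suc n) (n !)))
  (solve 3 (λ x y z → x :* y :* z := y :* (x :* z)) refl (ℕ→ℚ (suc n)) (ℕ→ℚ (n !)) (a (suc n)))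

egf-cauchy : ∀ a b n → egf (cauchy a b) n ≡ (egf a ⊛ egf b) n
egf-cauchy a b zero    = solve 2 (λ x y → con 1ℚ :* (x :* y) := con 1ℚ :* x :* (con 1ℚ :* y)) refl (a 0) (b 0)
egf-cauchy a b (suc n) = begin
  egf (cauchy a b) (suc n)
    ≡⟨ egf-suc (cauchy a b) n ⟩
  ℕ→ℚ (n !) * deriv (cauchy a b) n
    ≡⟨ cong (ℕ→ℚ (n !) *_) (cauchy-leibniz a b n) ⟩
  ℕ→ℚ (n !) * (cauchy (deriv a) b n + cauchy a (deriv b) n)
    ≡⟨ *-distribˡ-+ (ℕ→ℚ (n !)) (cauchy (deriv a) b n) (cauchy a (deriv b) n) ⟩
  egf (cauchy (deriv a) b) n + egf (cauchy a (deriv b)) n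
    ≡⟨ cong₂ _+_ (egf-cauchy (deriv a) b n) (egf-cauchy a (deriv b) n) ⟩
  (egf (deriv a) ⊛ egf b) n + (egf a ⊛ egf (deriv b)) n
    ≡⟨ cong₂ _+_ (⊛-cong (egf-suc a) (λ _ → refl) n) (⊛-cong (λ _ → refl) (egf-suc b) n) ⟨
  (egf a ⊛ egf b) (suc n) ∎
  where open ≡-Reasoning

-- The helper functions of cosC and sinC are local to Defs and cannot be named;
-- abstracting if_then_else_ and sgn in the goal exposes their values to unification.
cond : Bool → ℚ → ℚ → ℚ
cond true  x y = x
cond false x y = y

if≡cond : ∀ b x y → (if b then x else y) ≡ cond b x y
if≡cond true  x y = refl
if≡cond false x y = refl

two-step : (ite : Bool → ℚ → ℚ → ℚ) → (∀ b x y → ite b x y ≡ cond b x y) → (sg : ℕ → ℚ) → ∀ b h y u v →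
  ite b ((- sg h) * (y * u * v)) 0ℚ ≡ - (ite b (sg h * y) 0ℚ * (u * v))
two-step ite p sg b h y u v =
  trans (p b _ 0ℚ) (trans (lemma b) (cong (λ x → - (x * (u * v))) (sym (p b _ 0ℚ))))
  where
  lemma : ∀ b → cond b ((- sg h) * (y * u * v)) 0ℚ ≡ - (cond b (sg h * y) 0ℚ * (u * v))
  lemma true  = solve 4 (λ x y u v → (:- x) :* (y :* u :* v) := :- ((x :* y) :* (u :* v))) refl (sg h) y u v
  lemma false = cong -_ (sym (*-zeroˡ (u * v)))

cosC-2+ : ∀ k → cosC (suc (suc k)) ≡ - (cosC k * (invSuc k * invSuc (suc k)))
cosC-2+ k with if_then_else_ {A = ℚ} | if≡cond | sgn
... | ite | p | sg = two-step ite p sg _ _ (invFact k) (invSuc k) (invSuc (suc k))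

sinC-2+ : ∀ k → sinC (suc (suc (suc k))) ≡ - (sinC (suc k) * (invSuc (suc k) * invSuc (suc (suc k))))
sinC-2+ k with if_then_else_ {A = ℚ} | if≡cond | sgn
... | ite | p | sg = two-step ite p sg _ _ (invFact (suc k)) (invSuc (suc k)) (invSuc (suc (suc k)))

egf-2+ : ∀ a n → a (suc (suc n)) ≡ - (a n * (invSuc n * invSuc (suc n))) → egf a (suc (suc n)) ≡ - egf a n
egf-2+ a n e = begin
  ℕ→ℚ (suc (suc n) ℕ.* (suc n ℕ.* (n !))) * a (suc (suc n))
    ≡⟨ cong₂ _*_ (trans (ℕ→ℚ-* (suc (suc n)) (suc n ℕ.* (n !))) (cong (ℕ→ℚ (suc (suc n)) *_) (ℕ→ℚ-* (suc n) (n !)))) e ⟩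
  ℕ→ℚ (suc (suc n)) * (ℕ→ℚ (suc n) * ℕ→ℚ (n !)) * - (a n * (invSuc n * invSuc (suc n)))
    ≡⟨ solve 6 (λ x y f a u v → x :* (y :* f) :* (:- (a :* (u :* v))) := :- ((x :* v) :* (y :* u) :* (f :* a))) refl
         (ℕ→ℚ (suc (suc n))) (ℕ→ℚ (suc n)) (ℕ→ℚ (n !)) (a n) (invSuc n) (invSuc (suc n)) ⟩
  - ((ℕ→ℚ (suc (suc n)) * invSuc (suc n)) * (ℕ→ℚ (suc n) * invSuc n) * egf a n)
    ≡⟨ cong₂ (λ x y → - (x * y * egf a n)) (ℕ→ℚ-invSuc (suc n)) (ℕ→ℚ-invSuc n) ⟩
  - (1ℚ * 1ℚ * egf a n)
    ≡⟨ cong -_ (*-identityˡ (egf a n)) ⟩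
  - egf a n ∎
  where open ≡-Reasoning

egf-cosC : ∀ n → egf cosC n ≡ cosS n
egf-cosC zero          = refl
egf-cosC (suc zero)    = refl
egf-cosC (suc (suc n)) = trans (egf-2+ cosC n (cosC-2+ n)) (cong -_ (egf-cosC n))

egf-sinC : ∀ n → egf sinC n ≡ sinS n
egf-sinC zero                = refl
egf-sinC (suc zero)          = refl
egf-sinC (suc (suc zero))    = refl
egf-sinC (suc (suc (suc n))) = trans (egf-2+ sinC (suc n) (sinC-2+ n)) (cong -_ (egf-sinC (suc n)))

secTan : Seq
secTan n = headℚ (secTanRev n)

-- `secTanRev` lists coefficients in descending degree, so pairing it with ascending cosine indices
-- is a Cauchy product.
conv-cauchy : ∀ j n → conv j (secTanRev n) ≡ cauchy (λ k → cosC (suc j ℕ.+ k)) secTan n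
conv-cauchy j zero    = trans (+-identityʳ (cosC (suc j) * 1ℚ)) (cong (λ i → cosC (suc i) * 1ℚ) (sym (ℕₚ.+-identityʳ j)))
conv-cauchy j (suc n) = cong₂ _+_
  (cong (λ i → cosC (suc i) * secTan (suc n)) (sym (ℕₚ.+-identityʳ j)))
  (trans (conv-cauchy (suc j) n) (cauchy-cong (λ k → cong (λ i → cosC (suc i)) (sym (ℕₚ.+-suc j k))) (λ _ → refl) n))

cos·secTan : ∀ n → cauchy cosC secTan n ≡ δ 0 n + sinC n
cos·secTan zero    = refl
cos·secTan (suc n) = begin
  1ℚ * secTan (suc n) + cauchy (shift cosC) secTan n
    ≡⟨ cong₂ _+_ (*-identityˡ (secTan (suc n))) (sym (conv-cauchy 0 n)) ⟩
  (sinC (suc n) - conv 0 (secTanRev n)) + conv 0 (secTanRev n)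
    ≡⟨ solve 2 (λ s c → (s :- c) :+ c := con 0ℚ :+ s) refl (sinC (suc n)) (conv 0 (secTanRev n)) ⟩
  0ℚ + sinC (suc n) ∎
  where open ≡-Reasoning

cos⊛euler : ∀ n → (cosS ⊛ euler) n ≡ δ 0 n + sinS n
cos⊛euler n = begin
  (cosS ⊛ euler) n                     ≡⟨ ⊛-cong egf-cosC (λ _ → refl) n ⟨
  (egf cosC ⊛ egf secTan) n            ≡⟨ egf-cauchy cosC secTan n ⟨
  ℕ→ℚ (n !) * cauchy cosC secTan n     ≡⟨ cong (ℕ→ℚ (n !) *_) (cos·secTan n) ⟩
  ℕ→ℚ (n !) * (δ 0 n + sinC n)         ≡⟨ *-distribˡ-+ (ℕ→ℚ (n !)) (δ 0 n) (sinC n) ⟩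
  ℕ→ℚ (n !) * δ 0 n + egf sinC n       ≡⟨ cong₂ _+_ (egf-unit n) (egf-sinC n) ⟩
  δ 0 n + sinS n                       ∎
  where
  open ≡-Reasoning
  egf-unit : ∀ n → ℕ→ℚ (n !) * δ 0 n ≡ δ 0 n
  egf-unit zero    = refl
  egf-unit (suc n) = *-zeroʳ (ℕ→ℚ (suc n !))

-- Umbral evaluation

umbralFrom-add : ∀ k p q → umbralFrom k (addP p q) ≡ umbralFrom k p + umbralFrom k q
umbralFrom-add k []      q       = sym (+-identityˡ (umbralFrom k q))
umbralFrom-add k (a ∷ p) []      = sym (+-identityʳ (umbralFrom k (a ∷ p)))
umbralFrom-add k (a ∷ p) (b ∷ q) = trans (cong ((a + b) * euler k +_) (umbralFrom-add (suc k) p q))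
  (solve 5 (λ a b e x y → (a :+ b) :* e :+ (x :+ y) := (a :* e :+ x) :+ (b :* e :+ y)) refl
    a b (euler k) (umbralFrom (suc k) p) (umbralFrom (suc k) q))

umbralFrom-scale : ∀ k c p → umbralFrom k (scaleP c p) ≡ c * umbralFrom k p
umbralFrom-scale k c []      = sym (*-zeroʳ c)
umbralFrom-scale k c (a ∷ p) = trans (cong (c * a * euler k +_) (umbralFrom-scale (suc k) c p))
  (solve 4 (λ c a e x → c :* a :* e :+ c :* x := c :* (a :* e :+ x)) refl c a (euler k) (umbralFrom (suc k) p))

umbralFrom-0∷ : ∀ k p → umbralFrom k (0ℚ ∷ p) ≡ umbralFrom (suc k) p
umbralFrom-0∷ k p = trans (cong (_+ umbralFrom (suc k) p) (*-zeroˡ (euler k))) (+-identityˡ _)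

umbralFrom-const : ∀ k c q → umbralFrom k (mulP (constP c) q) ≡ c * umbralFrom k q
umbralFrom-const k c q = trans (umbralFrom-add k (scaleP c q) (0ℚ ∷ []))
  (trans (cong₂ _+_ (umbralFrom-scale k c q) (umbralFrom-0∷ k [])) (+-identityʳ _))

umbralFrom-E : ∀ k c q → umbralFrom k (mulP (Epoly c) q) ≡ c * umbralFrom (suc k) q
umbralFrom-E k c q = begin
  umbralFrom k (addP (scaleP 0ℚ q) (0ℚ ∷ mulP (constP c) q))
    ≡⟨ umbralFrom-add k (scaleP 0ℚ q) (0ℚ ∷ mulP (constP c) q) ⟩
  umbralFrom k (scaleP 0ℚ q) + umbralFrom k (0ℚ ∷ mulP (constP c) q)
    ≡⟨ cong₂ _+_ (trans (umbralFrom-scale k 0ℚ q) (*-zeroˡ (umbralFrom k q)))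
                 (trans (umbralFrom-0∷ k (mulP (constP c) q)) (umbralFrom-const (suc k) c q)) ⟩
  0ℚ + c * umbralFrom (suc k) q
    ≡⟨ +-identityˡ _ ⟩
  c * umbralFrom (suc k) q ∎
  where open ≡-Reasoning

monomial : (ℕ → Poly) → List ℕ → Poly
monomial a l = foldr mulP (constP 1ℚ) (map a l)

neg-involutive : ∀ x → - - x ≡ x
neg-involutive = solve 1 (λ x → :- (:- x) := x) refl

-- The values at 2 and 4 are described only by their effect under `umbralFrom`, because zero is
-- stored as an empty list and nonzero constants as singletons.
record Specialisation (s : ℚ) (a : ℕ → Poly) : Set where
  field
    at-1   : a 1 ≡ Epoly 1ℚ
    at-2   : ∀ k q → umbralFrom k (mulP (a 2) q) ≡ - (s * umbralFrom k q)
    at-3   : a 3 ≡ Epoly (- 1ℚ)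
    at-4   : ∀ k q → umbralFrom k (mulP (a 4) q) ≡ s * umbralFrom k q
    period : ∀ i → a (5 ℕ.+ i) ≡ a (suc i)

module _ {s a} (spec : Specialisation s a) where
  open Specialisation spec
  open ≡-Reasoning

  -- The index k counts the factors E already extracted, each of which shifts the Euler sequence by
  -- one.
  umbral-monomial : ∀ k l → umbralFrom k (monomial a (map suc l)) ≡ M s (λ n → euler (k ℕ.+ n)) l
  umbral-monomial-shift : ∀ k l → umbralFrom (suc k) (monomial a (map suc l)) ≡ M s (λ n → euler (k ℕ.+ suc n)) l

  umbral-monomial k [] = trans (+-identityʳ (1ℚ * euler k)) (trans (*-identityˡ (euler k)) (cong euler (sym (ℕₚ.+-identityʳ k))))
  umbral-monomial k (0 ∷ l) = begin
    umbralFrom k (mulP (a 1) q)        ≡⟨ cong (λ p → umbralFrom k (mulP p q)) at-1 ⟩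
    umbralFrom k (mulP (Epoly 1ℚ) q)   ≡⟨ umbralFrom-E k 1ℚ q ⟩
    1ℚ * umbralFrom (suc k) q          ≡⟨ *-identityˡ _ ⟩
    umbralFrom (suc k) q               ≡⟨ umbral-monomial-shift k l ⟩
    M s (λ n → euler (k ℕ.+ suc n)) l  ∎
    where q = monomial a (map suc l)
  umbral-monomial k (1 ∷ l) = trans (at-2 k (monomial a (map suc l))) (cong (λ x → - (s * x)) (umbral-monomial k l))
  umbral-monomial k (2 ∷ l) = begin
    umbralFrom k (mulP (a 3) q)            ≡⟨ cong (λ p → umbralFrom k (mulP p q)) at-3 ⟩
    umbralFrom k (mulP (Epoly (- 1ℚ)) q)   ≡⟨ umbralFrom-E k (- 1ℚ) q ⟩
    - 1ℚ * umbralFrom (suc k) q            ≡⟨ neg-distribˡ-* 1ℚ (umbralFrom (suc k) q) ⟨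
    - (1ℚ * umbralFrom (suc k) q)          ≡⟨ cong -_ (trans (*-identityˡ (umbralFrom (suc k) q)) (umbral-monomial-shift k l)) ⟩
    - M s (λ n → euler (k ℕ.+ suc n)) l    ∎
    where q = monomial a (map suc l)
  umbral-monomial k (3 ∷ l) = begin
    umbralFrom k (mulP (a 4) q)                  ≡⟨ at-4 k q ⟩
    s * umbralFrom k q                           ≡⟨ cong (s *_) (umbral-monomial k l) ⟩
    s * M s (λ n → euler (k ℕ.+ n)) l            ≡⟨ neg-involutive (s * M s (λ n → euler (k ℕ.+ n)) l) ⟨
    - - (s * M s (λ n → euler (k ℕ.+ n)) l)      ∎
    where q = monomial a (map suc l)
  -- The tables have period 4, whereas `M` lowers a letter by 2 with a sign; two such steps give the
  -- double negation.
  umbral-monomial k (suc (suc (suc (suc i))) ∷ l) = begin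
    umbralFrom k (mulP (a (5 ℕ.+ i)) q)             ≡⟨ cong (λ p → umbralFrom k (mulP p q)) (period i) ⟩
    umbralFrom k (mulP (a (suc i)) q)               ≡⟨ umbral-monomial k (i ∷ l) ⟩
    M s (λ n → euler (k ℕ.+ n)) (i ∷ l)             ≡⟨ neg-involutive (M s (λ n → euler (k ℕ.+ n)) (i ∷ l)) ⟨
    - - M s (λ n → euler (k ℕ.+ n)) (i ∷ l)         ∎
    where q = monomial a (map suc l)

  umbral-monomial-shift k l = trans (umbral-monomial (suc k) l)
    (M-cong s (λ n → cong euler (sym (ℕₚ.+-suc k n))) l)

specOdd-specialisation : Specialisation 0ℚ specOdd
specOdd-specialisation = record
  { at-1   = refl
  ; at-2   = λ k q → cong -_ (sym (*-zeroˡ (umbralFrom k q)))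
  ; at-3   = refl
  ; at-4   = λ k q → sym (*-zeroˡ (umbralFrom k q))
  ; period = λ i → refl
  }

specEvenτ-specialisation : Specialisation 1ℚ specEvenτ
specEvenτ-specialisation = record
  { at-1   = refl
  ; at-2   = λ k q → trans (umbralFrom-const k (- 1ℚ) q) (sym (neg-distribˡ-* 1ℚ (umbralFrom k q)))
  ; at-3   = refl
  ; at-4   = λ k q → umbralFrom-const k 1ℚ q
  ; period = λ i → refl
  }

specEvenτ'-specialisation : Specialisation (- 1ℚ) specEvenτ'
specEvenτ'-specialisation = record
  { at-1   = refl
  ; at-2   = λ k q → trans (umbralFrom-const k 1ℚ q) (sym (solve 1 (λ x → :- (con (- 1ℚ) :* x) := con 1ℚ :* x) refl (umbralFrom k q)))
  ; at-3   = refl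
  ; at-4   = λ k q → umbralFrom-const k (- 1ℚ) q
  ; period = λ i → refl
  }

positive-word : ∀ {l} → All (1 ≤_) l → ∃[ w ] l ≡ map suc w
positive-word []                       = [] , refl
positive-word (_∷_ {suc i} (s≤s _) ps) with positive-word ps
... | w , refl = i ∷ w , refl

pairing-∷ : ∀ c w f g → ⟨ (c , map suc w) ∷ f , g ⟩ ≡ c * ev g w + ⟨ f , g ⟩
pairing-∷ c w f g = trans (Σℚ-++ (map term g) _) (cong (_+ ⟨ f , g ⟩) (lemma g))
  where
  term : ℚ × List ℕ → ℚ
  term (d , m) = c * d * pInner (map suc w) m
  lemma : ∀ g → Σℚ (map term g) ≡ c * ev g w
  lemma []            = sym (*-zeroʳ c)
  lemma ((d , m) ∷ g) = trans (cong (c * d * ⟨p m ,p⟩ w +_) (lemma g))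
    (solve 4 (λ c d p e → c :* d :* p :+ c :* e := c :* (d :* p :+ e)) refl c d (⟨p m ,p⟩ w) (ev g w))

-- Both sides are linear in f, and every term of f is a multiple of some p_w of degree n, so g has
-- to agree with `M s euler` in that degree only.
pairing-umbral : ∀ {n s a} g → Specialisation s a → (∀ w → size w ≡ n → ev g w ≡ M s euler w) →
  ∀ f → Homogeneous n f → ⟨ f , g ⟩ ≡ umbral (substS f a)
pairing-umbral g spec g≡M []            []                    = refl
pairing-umbral {n} {s} {a} g spec g≡M ((c , l) ∷ f) ((pos , deg) ∷ hom) with positive-word pos
... | w , refl = begin
  ⟨ (c , map suc w) ∷ f , g ⟩
    ≡⟨ pairing-∷ c w f g ⟩
  c * ev g w + ⟨ f , g ⟩
    ≡⟨ cong₂ (λ x y → c * x + y) (trans (g≡M w deg) (sym (umbral-monomial spec 0 w))) (pairing-umbral g spec g≡M f hom) ⟩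
  c * umbral (monomial a (map suc w)) + umbral (substS f a)
    ≡⟨ cong (_+ umbral (substS f a)) (umbralFrom-scale 0 c (monomial a (map suc w))) ⟨
  umbral (scaleP c (monomial a (map suc w))) + umbral (substS f a)
    ≡⟨ umbralFrom-add 0 (scaleP c (monomial a (map suc w))) (substS f a) ⟨
  umbral (substS ((c , map suc w) ∷ f) a) ∎
  where open ≡-Reasoning

-- The four parity cases

%2≡1⇒odd : ∀ n → n % 2 ≡ 1 → odd n ≡ true
%2≡1⇒odd (suc zero)    _ = refl
%2≡1⇒odd (suc (suc n)) e = trans (odd-2+ n) (%2≡1⇒odd n e)

%2≡0⇒even : ∀ n → n % 2 ≡ 0 → odd n ≡ false
%2≡0⇒even zero          _ = refl
%2≡0⇒even (suc (suc n)) e = trans (odd-2+ n) (%2≡0⇒even n e)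

open Ribbons euler refl refl cos⊛euler

ev-sTau-odd : ∀ n → odd n ≡ true → ∀ w → size w ≡ n → ev (sTau n) w ≡ M 0ℚ euler w
ev-sTau-odd (suc k) n-odd w e = trans (ev-ribbon 1 (twos k) w) (τ-odd k (not-flip n-odd) w e)

ev-sTau'-odd : ∀ n → odd n ≡ true → ∀ w → size w ≡ n → ev (sTau' n) w ≡ M 0ℚ euler w
ev-sTau'-odd (suc zero)    _     w e = trans (ev-ribbon 1 [] w) (τ'-one w e)
ev-sTau'-odd (suc (suc k)) n-odd w e = trans (ev-ribbon 2 (twos k) w) (τ'-odd k (trans (sym (odd-2+ k)) n-odd) w e)

ev-sTau-even : ∀ n → 1 ≤ n → odd n ≡ false → ∀ w → size w ≡ n → ev (sTau n) w ≡ M 1ℚ euler w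
ev-sTau-even (suc k) _ n-even w e = trans (ev-ribbon 1 (twos k) w) (τ-even k (not-flip n-even) w e)

ev-sTau'-even : ∀ n → 1 ≤ n → odd n ≡ false → ∀ w → size w ≡ n → ev (sTau' n) w ≡ M (- 1ℚ) euler w
ev-sTau'-even (suc (suc k)) _ n-even w e = trans (ev-ribbon 2 (twos k) w) (τ'-even k (trans (sym (odd-2+ k)) n-even) w e)

theorem2p3 : (n : ℕ) → 1 ≤ n → (f : Sym) → Homogeneous n f →
    (n % 2 ≡ 1 →
    (⟨ f , sTau n ⟩ ≡ umbral (substS f specOdd)) ×
    (⟨ f , sTau' n ⟩ ≡ umbral (substS f specOdd))) ×
    (n % 2 ≡ 0 →
    (⟨ f , sTau n ⟩ ≡ umbral (substS f specEvenτ)) ×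
    (⟨ f , sTau' n ⟩ ≡ umbral (substS f specEvenτ')))
theorem2p3 n 1≤n f hom =
  (λ e → let n-odd = %2≡1⇒odd n e in
      pairing-umbral (sTau n) specOdd-specialisation (ev-sTau-odd n n-odd) f hom
    , pairing-umbral (sTau' n) specOdd-specialisation (ev-sTau'-odd n n-odd) f hom)
  ,
  (λ e → let n-even = %2≡0⇒even n e in
      pairing-umbral (sTau n) specEvenτ-specialisation (ev-sTau-even n 1≤n n-even) f hom
    , pairing-umbral (sTau' n) specEvenτ'-specialisation (ev-sTau'-even n 1≤n n-even) f hom)
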